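{- For every field $K$ and every non-empty finite set $X$, the first-order theory of the free associative non-unitary algebra $\mathbb{A}^0_K(X)$, in the language of rings, is undecidable.
   Context: $\mathbb{A}^0_K(X)$ denotes the free associative algebra without unity over the field $K$ with basis $X$: the $K$-linear combinations of non-empty non-commutative monomials in $X$. It is regarded as a structure in the language of rings $\{+,\cdot,0\}$. -}

module Defs where

open import Level using (Level; _⊔_) renaming (suc to lsuc)
open import Algebra.Bundles using (CommutativeRing)
open import Data.Nat using (ℕ; zero; suc; _+_; _<_)
open import Data.Fin using (Fin; toℕ) renaming (zero to fzero; suc to fsuc)
import Data.Fin.Properties as FinP
open import Data.List using (List; []; _∷_; _++_; concatMap; map)
import Data.List.Properties as ListP
open import Data.Vec using (Vec; []; _∷_)
open import Data.Product using (Σ; ∃; _×_; _,_; proj₁; proj₂)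
import Data.Product.Properties as ProdP
open import Data.Empty using (⊥)
open import Relation.Nullary using (¬_; yes; no)
open import Relation.Binary.PropositionalEquality using (_≡_)
open import Relation.Binary.Definitions using (DecidableEquality)

record Field (c ℓ : Level) : Set (lsuc (c ⊔ ℓ)) where
  field
    commutativeRing : CommutativeRing c ℓ
  open CommutativeRing commutativeRing public
  field
    1≉0     : ¬ (1# ≈ 0#)
    inverse : ∀ x → ¬ (x ≈ 0#) → ∃ λ y → (x * y) ≈ 1#

-- The free associative non-unitary algebra A⁰_K(X), X = Fin n.
-- A non-empty non-commutative monomial x_{i0} x_{i1} ... x_{ik} is
-- represented as (i0 , [i1 , ... , ik]).

Monomial : ℕ → Set
Monomial n = Fin n × List (Fin n)

_≟ₘ_ : ∀ {n} → DecidableEquality (Monomial n)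
_≟ₘ_ = ProdP.≡-dec FinP._≟_ (ListP.≡-dec FinP._≟_)

_·ₘ_ : ∀ {n} → Monomial n → Monomial n → Monomial n
(x , xs) ·ₘ (y , ys) = x , (xs ++ (y ∷ ys))

module FreeAlgebra {c ℓ : Level} (K : Field c ℓ) (n : ℕ) where
  open Field K using (Carrier; 0#; _≈_) renaming (_+_ to _+ᴷ_; _*_ to _*ᴷ_)

  -- an element is a formal finite K-linear combination of monomials
  Elem : Set c
  Elem = List (Carrier × Monomial n)

  coeff : Elem → Monomial n → Carrier
  coeff []             m = 0#
  coeff ((a , m') ∷ p) m with m ≟ₘ m'
  ... | yes _ = a +ᴷ coeff p m
  ... | no  _ = coeff p m

  _≈ᴬ_ : Elem → Elem → Set ℓ
  p ≈ᴬ q = ∀ m → coeff p m ≈ coeff q m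

  0ᴬ : Elem
  0ᴬ = []

  _+ᴬ_ : Elem → Elem → Elem
  p +ᴬ q = p ++ q

  _*ᴬ_ : Elem → Elem → Elem
  p *ᴬ q = concatMap (λ am → map (λ bm' → (proj₁ am *ᴷ proj₁ bm') , (proj₂ am ·ₘ proj₂ bm')) q) p

data Term (k : ℕ) : Set where
  var   : Fin k → Term k
  `0    : Term k
  _`+_  : Term k → Term k → Term k
  _`·_  : Term k → Term k → Term k

data Formula (k : ℕ) : Set where
  _`≐_  : Term k → Term k → Formula k
  `⊥    : Formula k
  _`∧_  : Formula k → Formula k → Formula k
  _`∨_  : Formula k → Formula k → Formula k
  _`⇒_  : Formula k → Formula k → Formula k
  `∀    : Formula (suc k) → Formula k
  `∃    : Formula (suc k) → Formula k

Sentence : Set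
Sentence = Formula 0

-- classical (Tarskian) satisfaction, rendered in constructive type theory
-- via the Gödel–Gentzen negative translation (∨, ∃ and atoms double-negated)
module Semantics {c ℓ : Level} (K : Field c ℓ) (n : ℕ) where
  open FreeAlgebra K n

  extend : ∀ {k} → Elem → (Fin k → Elem) → Fin (suc k) → Elem
  extend a ρ fzero    = a
  extend a ρ (fsuc i) = ρ i

  ⟦_⟧ₜ : ∀ {k} → Term k → (Fin k → Elem) → Elem
  ⟦ var i ⟧ₜ  ρ = ρ i
  ⟦ `0 ⟧ₜ     ρ = 0ᴬ
  ⟦ s `+ t ⟧ₜ ρ = ⟦ s ⟧ₜ ρ +ᴬ ⟦ t ⟧ₜ ρ
  ⟦ s `· t ⟧ₜ ρ = ⟦ s ⟧ₜ ρ *ᴬ ⟦ t ⟧ₜ ρ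

  Sat : ∀ {k} → Formula k → (Fin k → Elem) → Set (c ⊔ ℓ)
  Sat (s `≐ t) ρ = ¬ ¬ Level.Lift c (⟦ s ⟧ₜ ρ ≈ᴬ ⟦ t ⟧ₜ ρ)
  Sat `⊥       ρ = Level.Lift (c ⊔ ℓ) ⊥
  Sat (φ `∧ ψ) ρ = Sat φ ρ × Sat ψ ρ
  Sat (φ `∨ ψ) ρ = ¬ (¬ Sat φ ρ × ¬ Sat ψ ρ)
  Sat (φ `⇒ ψ) ρ = Sat φ ρ → Sat ψ ρ
  Sat (`∀ φ)   ρ = ∀ a → Sat φ (extend a ρ)
  Sat (`∃ φ)   ρ = ¬ (∀ a → ¬ Sat φ (extend a ρ))

  empty : Fin 0 → Elem
  empty ()

  True : Sentence → Set (c ⊔ ℓ)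
  True φ = Sat φ empty

-- Gödel numbering of formulas (Cantor pairing)

tri : ℕ → ℕ
tri zero    = zero
tri (suc k) = suc k + tri k

pair : ℕ → ℕ → ℕ
pair a b = tri (a + b) + b

⌜_⌝ₜ : ∀ {k} → Term k → ℕ
⌜ var i ⌝ₜ  = pair 0 (toℕ i)
⌜ `0 ⌝ₜ     = pair 1 0
⌜ s `+ t ⌝ₜ = pair 2 (pair ⌜ s ⌝ₜ ⌜ t ⌝ₜ)
⌜ s `· t ⌝ₜ = pair 3 (pair ⌜ s ⌝ₜ ⌜ t ⌝ₜ)

⌜_⌝ : ∀ {k} → Formula k → ℕ
⌜ s `≐ t ⌝ = pair 0 (pair ⌜ s ⌝ₜ ⌜ t ⌝ₜ)
⌜ `⊥ ⌝     = pair 1 0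
⌜ φ `∧ ψ ⌝ = pair 2 (pair ⌜ φ ⌝ ⌜ ψ ⌝)
⌜ φ `∨ ψ ⌝ = pair 3 (pair ⌜ φ ⌝ ⌜ ψ ⌝)
⌜ φ `⇒ ψ ⌝ = pair 4 (pair ⌜ φ ⌝ ⌜ ψ ⌝)
⌜ `∀ φ ⌝   = pair 5 ⌜ φ ⌝
⌜ `∃ φ ⌝   = pair 6 ⌜ φ ⌝

data PRec : ℕ → Set where
  zeroF : ∀ {k} → PRec k
  succF : PRec 1
  proj  : ∀ {k} → Fin k → PRec k
  comp  : ∀ {k m} → PRec m → Vec (PRec k) m → PRec k
  prim  : ∀ {k} → PRec k → PRec (suc (suc k)) → PRec (suc k)
  mu    : ∀ {k} → PRec (suc k) → PRec k

lookupV : ∀ {k} → Vec ℕ k → Fin k → ℕ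
lookupV (x ∷ xs) fzero    = x
lookupV (x ∷ xs) (fsuc i) = lookupV xs i

mutual
  data Eval : ∀ {k} → PRec k → Vec ℕ k → ℕ → Set where
    e-zero : ∀ {k} {xs : Vec ℕ k} → Eval zeroF xs 0
    e-succ : ∀ {x} → Eval succF (x ∷ []) (suc x)
    e-proj : ∀ {k} {i : Fin k} {xs} → Eval (proj i) xs (lookupV xs i)
    e-comp : ∀ {k m} {f : PRec m} {gs : Vec (PRec k) m} {xs ys y} →
             EvalAll gs xs ys → Eval f ys y → Eval (comp f gs) xs y
    e-prim0 : ∀ {k} {f : PRec k} {g} {xs y} →
              Eval f xs y → Eval (prim f g) (0 ∷ xs) y
    e-primS : ∀ {k} {f : PRec k} {g} {x xs r y} →
              Eval (prim f g) (x ∷ xs) r → Eval g (x ∷ r ∷ xs) y →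
              Eval (prim f g) (suc x ∷ xs) y
    e-mu   : ∀ {k} {f : PRec (suc k)} {xs y} →
             Eval f (y ∷ xs) 0 →
             (∀ z → z < y → ∃ λ w → Eval f (z ∷ xs) (suc w)) →
             Eval (mu f) xs y

  data EvalAll {k} : ∀ {m} → Vec (PRec k) m → Vec ℕ k → Vec ℕ m → Set where
    []  : ∀ {xs} → EvalAll [] xs []
    _∷_ : ∀ {m g y} {gs : Vec (PRec k) m} {xs ys} →
          Eval g xs y → EvalAll gs xs ys → EvalAll (g ∷ gs) xs (y ∷ ys)

DecidableSet : ∀ {a} → (ℕ → Set a) → Set a
DecidableSet S = ∃ λ (f : PRec 1) →
  ∀ x → (S x → Eval f (x ∷ []) 1) × (¬ S x → Eval f (x ∷ []) 0)

TheoryCodes : ∀ {c ℓ} → Field c ℓ → ℕ → ℕ → Set (c ⊔ ℓ)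
TheoryCodes K n x = Σ Sentence λ φ → (⌜ φ ⌝ ≡ x) × Semantics.True K n φ

TheoryUndecidable : ∀ {c ℓ} → Field c ℓ → ℕ → Set (c ⊔ ℓ)
TheoryUndecidable K n = ¬ DecidableSet (TheoryCodes K n)

-- Tarski's argument: a function f deciding the theory would be represented by a formula, and a
-- sentence asserting "f rejects my code" would refute f. No constants are available, so that
-- sentence begins with ∃ t and a condition Good t, which makes {t, t², …} a definable copy of ℕ on
-- which finite sets of pairs can be coded by elements; such sets express primitive recursion.
--
-- Good t never needs to be analysed for unknown t: it postulates closure under t · _, predecessors,
-- the empty set and adjunction of a pair. Since ⋂ Aᵏ = 0, descending through predecessors shows
-- that every number is a power of t. It remains to verify Good x for one generator x. Elements
-- commuting with x are polynomials in x without constant term, and the powers of x are those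
-- nonzero u with u(1) = 1 all of whose divisors v with v(1) = 1 are x or multiples of x. Moreover
-- x^a - 1 ∣ x^b - 1 iff a ∣ b, so addition and divisibility of exponents are definable. A finite
-- set of k numbers v < B is coded by m = ∏ (v + e) with e > B^k: if w < B and w + e divides m then
-- w + e divides ∏ ∣v - w∣, which is too small unless it is zero, i.e. unless w is in the set.

module Submission where

open import Defs
open import Level using (Level; Lift; _⊔_; lift; lower)
import Data.Nat as ℕ
import Data.Nat.Properties as ℕ
open import Data.Nat using (ℕ; zero; suc; _<_; _≤_; z≤n; s≤s)
open import Data.Fin using (Fin; toℕ; #_) renaming (zero to fzero; suc to fsuc)
import Data.Fin.Properties as FinP
open import Data.List using (List; []; _∷_; _++_; map; length; replicate)
import Data.List.Properties as ListP
open import Data.List.Membership.Propositional using (_∈_)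
open import Data.List.Relation.Unary.Any using (here; there)
open import Data.Vec using (Vec; []; _∷_; lookup; toList)
open import Data.Product using (Σ; ∃; _×_; _,_; proj₁; proj₂)
open import Data.Sum using (_⊎_; inj₁; inj₂)
open import Data.Empty using (⊥; ⊥-elim)
open import Data.Unit.Polymorphic using (⊤; tt)
open import Relation.Nullary using (¬_; yes; no)
open import Relation.Nullary.Decidable using (decidable-stable; _×-dec_)
open import Relation.Binary.Bundles using (Setoid)
open import Relation.Binary.Definitions using (tri<; tri≈; tri>)
import Relation.Binary.PropositionalEquality as ≡
open ≡ using (_≡_)

-- The absence of a unity shapes the formulas. The number `k` is the power t^(k+1), equality is a
-- separate case of being a left factor, and a condition such as t^a - 1 ∣ t^b - 1 is multiplied by
-- t, because its quotient has constant term 1, and then rearranged so that neither 1 nor a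
-- difference occurs. The characteristic is arbitrary, so numbers are never scalars; only exponents
-- count. A true sentence hands over some good t of which nothing else is known. The representation
-- of recursive functions therefore rests on the record `Arithmetic` alone, while polynomials are
-- studied only for the generator, to see that a good element exists. Equality in `K` need not be
-- decidable and satisfaction is a negative translation, so witnesses are available only under
-- double negation. This suffices: undecidability is itself a negation, formulas are stable, and the
-- facts needed about natural numbers are decidable.

module Computability where

  -- Injectivity of Gödel codes and recursive functions on them.

  open import Data.Nat using (_+_)

  tri-mono : ∀ {a b} → a ≤ b → tri a ≤ tri b
  tri-mono z≤n       = z≤n
  tri-mono (s≤s a≤b) = ℕ.+-mono-≤ (s≤s a≤b) (tri-mono a≤b)

  pair-< : ∀ a b a′ b′ → a + b < a′ + b′ → pair a b < pair a′ b′
  pair-< a b a′ b′ lt = begin-strict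
    tri (a + b) + b          ≤⟨ ℕ.+-monoʳ-≤ (tri (a + b)) (ℕ.m≤n+m b a) ⟩
    tri (a + b) + (a + b)    <⟨ ℕ.n<1+n _ ⟩
    suc (tri (a + b) + (a + b)) ≡⟨ ≡.cong suc (ℕ.+-comm (tri (a + b)) (a + b)) ⟩
    tri (suc (a + b))        ≤⟨ tri-mono lt ⟩
    tri (a′ + b′)            ≤⟨ ℕ.m≤m+n _ b′ ⟩
    tri (a′ + b′) + b′       ∎
    where open ℕ.≤-Reasoning

  pair-injective : ∀ a b a′ b′ → pair a b ≡ pair a′ b′ → a ≡ a′ × b ≡ b′
  pair-injective a b a′ b′ eq with ℕ.<-cmp (a + b) (a′ + b′)
  ... | tri< lt _ _ = ⊥-elim (ℕ.<⇒≢ (pair-< a b a′ b′ lt) eq)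
  ... | tri> _ _ gt = ⊥-elim (ℕ.<⇒≢ (pair-< a′ b′ a b gt) (≡.sym eq))
  ... | tri≈ _ s _  = ℕ.+-cancelʳ-≡ b a a′ (≡.trans s (≡.cong (a′ +_) (≡.sym b≡b′))) , b≡b′
    where
    b≡b′ : b ≡ b′
    b≡b′ = ℕ.+-cancelˡ-≡ (tri (a + b)) b b′ (≡.trans eq (≡.cong (λ k → tri k + b′) (≡.sym s)))

  -- A uniform splitting into tag and argument lets one use of `pair-injective` serve every pair of
  -- constructors; unequal tags dispose of the mixed cases.
  tagₜ argₜ : ∀ {k} → Term k → ℕ
  tagₜ (var i)  = 0
  tagₜ `0       = 1
  tagₜ (s `+ t) = 2
  tagₜ (s `· t) = 3
  argₜ (var i)  = toℕ i
  argₜ `0       = 0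
  argₜ (s `+ t) = pair ⌜ s ⌝ₜ ⌜ t ⌝ₜ
  argₜ (s `· t) = pair ⌜ s ⌝ₜ ⌜ t ⌝ₜ

  code≡ₜ : ∀ {k} (s : Term k) → ⌜ s ⌝ₜ ≡ pair (tagₜ s) (argₜ s)
  code≡ₜ (var i)  = ≡.refl
  code≡ₜ `0       = ≡.refl
  code≡ₜ (s `+ t) = ≡.refl
  code≡ₜ (s `· t) = ≡.refl

  mutual
    ⌜⌝ₜ-injective : ∀ {k} (s t : Term k) → ⌜ s ⌝ₜ ≡ ⌜ t ⌝ₜ → s ≡ t
    ⌜⌝ₜ-injective s t eq = split s t (proj₁ both) (proj₂ both)
      where
      both : tagₜ s ≡ tagₜ t × argₜ s ≡ argₜ t
      both = pair-injective (tagₜ s) (argₜ s) (tagₜ t) (argₜ t)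
               (≡.trans (≡.sym (code≡ₜ s)) (≡.trans eq (code≡ₜ t)))

      split : ∀ s t → tagₜ s ≡ tagₜ t → argₜ s ≡ argₜ t → s ≡ t
      split (var i) (var j) ≡.refl e = ≡.cong var (FinP.toℕ-injective e)
      split `0 `0 ≡.refl e = ≡.refl
      split (s₁ `+ s₂) (t₁ `+ t₂) ≡.refl e = ⌜⌝ₜ-injective₂ _`+_ s₁ s₂ t₁ t₂ e
      split (s₁ `· s₂) (t₁ `· t₂) ≡.refl e = ⌜⌝ₜ-injective₂ _`·_ s₁ s₂ t₁ t₂ e

    ⌜⌝ₜ-injective₂ : ∀ {k} {A : Set} (f : Term k → Term k → A) s₁ s₂ t₁ t₂ →
                     pair ⌜ s₁ ⌝ₜ ⌜ s₂ ⌝ₜ ≡ pair ⌜ t₁ ⌝ₜ ⌜ t₂ ⌝ₜ → f s₁ s₂ ≡ f t₁ t₂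
    ⌜⌝ₜ-injective₂ f s₁ s₂ t₁ t₂ e with pair-injective ⌜ s₁ ⌝ₜ ⌜ s₂ ⌝ₜ ⌜ t₁ ⌝ₜ ⌜ t₂ ⌝ₜ e
    ... | e₁ , e₂ = ≡.cong₂ f (⌜⌝ₜ-injective s₁ t₁ e₁) (⌜⌝ₜ-injective s₂ t₂ e₂)

  tag arg : ∀ {k} → Formula k → ℕ
  tag (s `≐ t) = 0
  tag `⊥       = 1
  tag (φ `∧ ψ) = 2
  tag (φ `∨ ψ) = 3
  tag (φ `⇒ ψ) = 4
  tag (`∀ φ)   = 5
  tag (`∃ φ)   = 6
  arg (s `≐ t) = pair ⌜ s ⌝ₜ ⌜ t ⌝ₜ
  arg `⊥       = 0
  arg (φ `∧ ψ) = pair ⌜ φ ⌝ ⌜ ψ ⌝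
  arg (φ `∨ ψ) = pair ⌜ φ ⌝ ⌜ ψ ⌝
  arg (φ `⇒ ψ) = pair ⌜ φ ⌝ ⌜ ψ ⌝
  arg (`∀ φ)   = ⌜ φ ⌝
  arg (`∃ φ)   = ⌜ φ ⌝

  code≡ : ∀ {k} (φ : Formula k) → ⌜ φ ⌝ ≡ pair (tag φ) (arg φ)
  code≡ (s `≐ t) = ≡.refl
  code≡ `⊥       = ≡.refl
  code≡ (φ `∧ ψ) = ≡.refl
  code≡ (φ `∨ ψ) = ≡.refl
  code≡ (φ `⇒ ψ) = ≡.refl
  code≡ (`∀ φ)   = ≡.refl
  code≡ (`∃ φ)   = ≡.refl

  mutual
    ⌜⌝-injective : ∀ {k} (φ ψ : Formula k) → ⌜ φ ⌝ ≡ ⌜ ψ ⌝ → φ ≡ ψ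
    ⌜⌝-injective φ ψ eq = split φ ψ (proj₁ both) (proj₂ both)
      where
      both : tag φ ≡ tag ψ × arg φ ≡ arg ψ
      both = pair-injective (tag φ) (arg φ) (tag ψ) (arg ψ)
               (≡.trans (≡.sym (code≡ φ)) (≡.trans eq (code≡ ψ)))

      split : ∀ φ ψ → tag φ ≡ tag ψ → arg φ ≡ arg ψ → φ ≡ ψ
      split (s₁ `≐ s₂) (t₁ `≐ t₂) ≡.refl e = ⌜⌝ₜ-injective₂ _`≐_ s₁ s₂ t₁ t₂ e
      split `⊥ `⊥ ≡.refl e = ≡.refl
      split (φ₁ `∧ φ₂) (ψ₁ `∧ ψ₂) ≡.refl e = ⌜⌝-injective₂ _`∧_ φ₁ φ₂ ψ₁ ψ₂ e
      split (φ₁ `∨ φ₂) (ψ₁ `∨ ψ₂) ≡.refl e = ⌜⌝-injective₂ _`∨_ φ₁ φ₂ ψ₁ ψ₂ e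
      split (φ₁ `⇒ φ₂) (ψ₁ `⇒ ψ₂) ≡.refl e = ⌜⌝-injective₂ _`⇒_ φ₁ φ₂ ψ₁ ψ₂ e
      split (`∀ φ) (`∀ ψ) ≡.refl e = ≡.cong `∀ (⌜⌝-injective φ ψ e)
      split (`∃ φ) (`∃ ψ) ≡.refl e = ≡.cong `∃ (⌜⌝-injective φ ψ e)

    ⌜⌝-injective₂ : ∀ {k} (f : Formula k → Formula k → Formula k) φ₁ φ₂ ψ₁ ψ₂ →
                    pair ⌜ φ₁ ⌝ ⌜ φ₂ ⌝ ≡ pair ⌜ ψ₁ ⌝ ⌜ ψ₂ ⌝ → f φ₁ φ₂ ≡ f ψ₁ ψ₂
    ⌜⌝-injective₂ f φ₁ φ₂ ψ₁ ψ₂ e with pair-injective ⌜ φ₁ ⌝ ⌜ φ₂ ⌝ ⌜ ψ₁ ⌝ ⌜ ψ₂ ⌝ e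
    ... | e₁ , e₂ = ≡.cong₂ f (⌜⌝-injective φ₁ ψ₁ e₁) (⌜⌝-injective φ₂ ψ₂ e₂)

  mutual
    Eval-functional : ∀ {k} {f : PRec k} {xs y z} → Eval f xs y → Eval f xs z → y ≡ z
    Eval-functional e-zero e-zero = ≡.refl
    Eval-functional e-succ e-succ = ≡.refl
    Eval-functional e-proj e-proj = ≡.refl
    Eval-functional (e-comp as a) (e-comp bs b) with ≡.refl ← EvalAll-functional as bs =
      Eval-functional a b
    Eval-functional (e-prim0 a) (e-prim0 b) = Eval-functional a b
    Eval-functional (e-primS a a′) (e-primS b b′) with ≡.refl ← Eval-functional a b =
      Eval-functional a′ b′
    Eval-functional {y = y} {z} (e-mu a as) (e-mu b bs) with ℕ.<-cmp y z
    ... | tri≈ _ y≡z _ = y≡z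
    ... | tri< y<z _ _ with () ← Eval-functional a (proj₂ (bs y y<z))
    ... | tri> _ _ z<y with () ← Eval-functional b (proj₂ (as z z<y))

    EvalAll-functional : ∀ {k m} {gs : Vec (PRec k) m} {xs ys zs} →
                         EvalAll gs xs ys → EvalAll gs xs zs → ys ≡ zs
    EvalAll-functional []       []       = ≡.refl
    EvalAll-functional (a ∷ as) (b ∷ bs) =
      ≡.cong₂ _∷_ (Eval-functional a b) (EvalAll-functional as bs)

  constF : ∀ {k} → ℕ → PRec k
  constF zero    = zeroF
  constF (suc n) = comp succF (constF n ∷ [])

  constF-eval : ∀ {k} n {xs : Vec ℕ k} → Eval (constF n) xs n
  constF-eval zero    = e-zero
  constF-eval (suc n) = e-comp (constF-eval n ∷ []) e-succ

  addF : PRec 2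
  addF = prim (proj fzero) (comp succF (proj (fsuc fzero) ∷ []))

  addF-eval : ∀ a b → Eval addF (a ∷ b ∷ []) (a + b)
  addF-eval zero    b = e-prim0 e-proj
  addF-eval (suc a) b = e-primS (addF-eval a b) (e-comp (e-proj ∷ []) e-succ)

  triF : PRec 1
  triF = prim zeroF (comp addF (comp succF (proj fzero ∷ []) ∷ proj (fsuc fzero) ∷ []))

  triF-eval : ∀ a → Eval triF (a ∷ []) (tri a)
  triF-eval zero    = e-prim0 e-zero
  triF-eval (suc a) = e-primS (triF-eval a)
    (e-comp (e-comp (e-proj ∷ []) e-succ ∷ e-proj ∷ []) (addF-eval (suc a) (tri a)))

  pairF : PRec 2
  pairF = comp addF (comp triF (addF ∷ []) ∷ proj (fsuc fzero) ∷ [])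

  pairF-eval : ∀ a b → Eval pairF (a ∷ b ∷ []) (pair a b)
  pairF-eval a b = e-comp
    (e-comp (addF-eval a b ∷ []) (triF-eval (a + b)) ∷ e-proj ∷ []) (addF-eval (tri (a + b)) b)

  pair[_,_] : ∀ {k} → PRec k → PRec k → PRec k
  pair[ f , g ] = comp pairF (f ∷ g ∷ [])

  pair-eval : ∀ {k} {f g : PRec k} {xs a b} →
              Eval f xs a → Eval g xs b → Eval pair[ f , g ] xs (pair a b)
  pair-eval {a = a} {b} d e = e-comp (d ∷ e ∷ []) (pairF-eval a b)

  powerTerm : ∀ {k} → Fin k → ℕ → Term k
  powerTerm t zero    = var t
  powerTerm t (suc k) = var t `· powerTerm t k

  -- The number is bound by an equation instead of being substituted. Thus `φ` occurs verbatim, with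
  -- variable 0 for the number and variable 1 for t, and the code of the sentence arises from that
  -- of `φ` by pairings alone.
  diagonal : Formula 1 → Formula 2 → ℕ → Sentence
  diagonal γ φ x = `∃ (γ `∧ `∃ ((var fzero `≐ powerTerm (fsuc fzero) x) `∧ φ))

  powerTermF : ℕ → PRec 1
  powerTermF v = prim (constF v) pair[ constF 3 , pair[ constF v , proj (fsuc fzero) ] ]

  powerTermF-eval : ∀ {k} (t : Fin k) x →
                    Eval (powerTermF (pair 0 (toℕ t))) (x ∷ []) ⌜ powerTerm t x ⌝ₜ
  powerTermF-eval t zero    = e-prim0 (constF-eval _)
  powerTermF-eval t (suc x) = e-primS (powerTermF-eval t x)
    (pair-eval (constF-eval 3) (pair-eval (constF-eval _) e-proj))

  diagonalF : ℕ → PRec 1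
  diagonalF g = pair[ constF 6 , pair[ constF 2 , pair[ constF g ,
    pair[ constF 6 , pair[ constF 2 , pair[
      -- The first 0 is the tag of an equation; the second is the code of `var fzero`, as `pair 0 0`
      -- computes to 0. The code of the variable t, one binder further out, is `pair 0 1`.
      pair[ constF 0 , pair[ constF 0 , powerTermF (pair 0 1) ] ] ,
      proj fzero ] ] ] ] ] ]

  diagonalF-eval : ∀ γ φ → Eval (diagonalF ⌜ γ ⌝) (⌜ φ ⌝ ∷ []) ⌜ diagonal γ φ ⌜ φ ⌝ ⌝
  diagonalF-eval γ φ = pair-eval (constF-eval 6) (pair-eval (constF-eval 2)
    (pair-eval (constF-eval ⌜ γ ⌝) (pair-eval (constF-eval 6) (pair-eval (constF-eval 2)
      (pair-eval (pair-eval (constF-eval 0) (pair-eval (constF-eval 0)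
        (powerTermF-eval (fsuc {n = 1} fzero) ⌜ φ ⌝))) e-proj)))))

-- Ring laws and degrees in the free algebra.

module FreeAlgebraLaws {c ℓ : Level} (K : Field c ℓ) (n : ℕ) where
  open Field K hiding (zero)
  open FreeAlgebra K n
  open import Relation.Binary.Reasoning.Setoid setoid
  open import Algebra.Properties.CommutativeSemigroup +-commutativeSemigroup
    using (interchange)

  Coeffs : Set c
  Coeffs = Fin n → List (Fin n) → Carrier

  cf : Elem → Coeffs
  cf p x ws = coeff p (x , ws)

  shift : Fin n → Coeffs → Coeffs
  shift x f y ys = f x (y ∷ ys)

  -- The sum over all cuts of a word into two non-empty words: the cut after the first letter, then
  -- the later ones, for which `shift` absorbs that letter. A one-letter word has no cut. Working
  -- with coefficient functions makes the ring laws inductions on the word.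
  conv : Coeffs → Coeffs → Coeffs
  conv f g x []       = 0#
  conv f g x (z ∷ zs) = f x [] * g z zs + conv (shift x f) g z zs

  infix 4 _≗_
  _≗_ : Coeffs → Coeffs → Set ℓ
  f ≗ g = ∀ x ws → f x ws ≈ g x ws

  conv-cong : ∀ {f f′ g g′} → f ≗ f′ → g ≗ g′ → conv f g ≗ conv f′ g′
  conv-cong p q x []       = refl
  conv-cong p q x (z ∷ zs) =
    +-cong (*-cong (p x []) (q z zs)) (conv-cong (λ y ys → p x (y ∷ ys)) q z zs)

  conv-+ˡ : ∀ f f′ g x ws →
            conv (λ y ys → f y ys + f′ y ys) g x ws ≈ conv f g x ws + conv f′ g x ws
  conv-+ˡ f f′ g x []       = sym (+-identityˡ 0#)
  conv-+ˡ f f′ g x (z ∷ zs) = trans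
    (+-cong (distribʳ _ _ _) (conv-+ˡ (shift x f) (shift x f′) g z zs))
    (interchange _ _ _ _)

  conv-+ʳ : ∀ f g g′ x ws →
            conv f (λ y ys → g y ys + g′ y ys) x ws ≈ conv f g x ws + conv f g′ x ws
  conv-+ʳ f g g′ x []       = sym (+-identityˡ 0#)
  conv-+ʳ f g g′ x (z ∷ zs) = trans
    (+-cong (distribˡ _ _ _) (conv-+ʳ (shift x f) g g′ z zs))
    (interchange _ _ _ _)

  conv-*ˡ : ∀ a f g x ws → conv (λ y ys → a * f y ys) g x ws ≈ a * conv f g x ws
  conv-*ˡ a f g x []       = sym (zeroʳ a)
  conv-*ˡ a f g x (z ∷ zs) = trans
    (+-cong (*-assoc a _ _) (conv-*ˡ a (shift x f) g z zs)) (sym (distribˡ a _ _))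

  conv-0ˡ : ∀ {f} g x ws → (∀ y ys → f y ys ≈ 0#) → conv f g x ws ≈ 0#
  conv-0ˡ g x []       f≈0 = refl
  conv-0ˡ g x (z ∷ zs) f≈0 = trans
    (+-cong (trans (*-congʳ (f≈0 x [])) (zeroˡ _)) (conv-0ˡ g z zs (λ y ys → f≈0 x (y ∷ ys))))
    (+-identityˡ 0#)

  conv-assoc : ∀ f g h → conv (conv f g) h ≗ conv f (conv g h)
  conv-assoc f g h x []       = refl
  conv-assoc f g h x (z ∷ zs) = begin
    0# * h z zs + conv (shift x (conv f g)) h z zs
      ≈⟨ +-cong (zeroˡ _) refl ⟩
    0# + conv (λ y ys → f x [] * g y ys + conv (shift x f) g y ys) h z zs
      ≈⟨ +-identityˡ _ ⟩
    conv (λ y ys → f x [] * g y ys + conv (shift x f) g y ys) h z zs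
      ≈⟨ conv-+ˡ (λ y ys → f x [] * g y ys) (conv (shift x f) g) h z zs ⟩
    conv (λ y ys → f x [] * g y ys) h z zs + conv (conv (shift x f) g) h z zs
      ≈⟨ +-cong (conv-*ˡ (f x []) g h z zs) (conv-assoc (shift x f) g h z zs) ⟩
    f x [] * conv g h z zs + conv (shift x f) (conv g h) z zs ∎

  -- The tail length is the degree less one. So `f` starts in degree d + 1 and `g` in degree e + 1,
  -- hence the product in degree d + e + 2, which is why equality is allowed in the bound on the
  -- tail.
  conv-low : ∀ f g d e → (∀ x ws → length ws < d → f x ws ≈ 0#) →
             (∀ x ws → length ws < e → g x ws ≈ 0#) →
             ∀ x ws → length ws ≤ d ℕ.+ e → conv f g x ws ≈ 0#
  conv-low f g d e f≈0 g≈0 x [] _ = refl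
  conv-low f g zero e f≈0 g≈0 x (z ∷ zs) lt = trans
    (+-cong (trans (*-congˡ (g≈0 z zs lt)) (zeroʳ _))
            (conv-low (shift x f) g zero e (λ _ _ ()) g≈0 z zs (ℕ.<⇒≤ lt)))
    (+-identityˡ 0#)
  conv-low f g (suc d) e f≈0 g≈0 x (z ∷ zs) (s≤s lt) = trans
    (+-cong (trans (*-congʳ (f≈0 x [] (s≤s z≤n))) (zeroˡ _))
            (conv-low (shift x f) g d e (λ y ys lt → f≈0 x (y ∷ ys) (s≤s lt)) g≈0 z zs lt))
    (+-identityˡ 0#)

  δ : Carrier → Monomial n → Monomial n → Carrier
  δ a m′ m with m ≟ₘ m′
  ... | yes _ = a
  ... | no  _ = 0#

  δ-same : ∀ a m → δ a m m ≈ a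
  δ-same a m with m ≟ₘ m
  ... | yes _ = refl
  ... | no ne = ⊥-elim (ne ≡.refl)

  δ-other : ∀ a m m′ → ¬ (m ≡ m′) → δ a m′ m ≈ 0#
  δ-other a m m′ ne with m ≟ₘ m′
  ... | yes e = ⊥-elim (ne e)
  ... | no _  = refl

  coeff-∷ : ∀ a m′ p m → coeff ((a , m′) ∷ p) m ≈ δ a m′ m + coeff p m
  coeff-∷ a m′ p m with m ≟ₘ m′
  ... | yes _ = refl
  ... | no  _ = sym (+-identityˡ _)

  coeff-+ : ∀ p q m → coeff (p +ᴬ q) m ≈ coeff p m + coeff q m
  coeff-+ []             q m = sym (+-identityˡ _)
  coeff-+ ((a , m′) ∷ p) q m = begin
    coeff ((a , m′) ∷ p ++ q) m            ≈⟨ coeff-∷ a m′ (p ++ q) m ⟩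
    δ a m′ m + coeff (p ++ q) m            ≈⟨ +-cong refl (coeff-+ p q m) ⟩
    δ a m′ m + (coeff p m + coeff q m)     ≈⟨ sym (+-assoc _ _ _) ⟩
    (δ a m′ m + coeff p m) + coeff q m     ≈⟨ +-cong (sym (coeff-∷ a m′ p m)) refl ⟩
    coeff ((a , m′) ∷ p) m + coeff q m     ∎

  δᶜ : Carrier → Fin n → List (Fin n) → Coeffs
  δᶜ a x ws y ys = δ a (x , ws) (y , ys)

  shift-δ : ∀ a x w ws → shift x (δᶜ a x (w ∷ ws)) ≗ δᶜ a w ws
  shift-δ a x w ws y ys with (y , ys) ≟ₘ (w , ws)
  ... | yes ≡.refl = δ-same a (x , w ∷ ws)
  ... | no ne      = δ-other a (x , y ∷ ys) (x , w ∷ ws) λ { ≡.refl → ne ≡.refl }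

  δ-head : ∀ a {x y} ws → ¬ (y ≡ x) → ∀ ys → δᶜ a x ws y ys ≈ 0#
  δ-head a {x} {y} ws ne ys = δ-other a (y , ys) (x , ws) λ { ≡.refl → ne ≡.refl }

  conv-head : ∀ f g y zs → (∀ ys → f y ys ≈ 0#) → conv f g y zs ≈ 0#
  conv-head f g y []       f≈0 = refl
  conv-head f g y (z ∷ zs) f≈0 = trans
    (+-cong (trans (*-congʳ (f≈0 [])) (zeroˡ _)) (conv-0ˡ g z zs (λ w ws → f≈0 (w ∷ ws))))
    (+-identityˡ 0#)

  -- Either the monomial is a proper prefix of the word or it is not; each case records what
  -- convolution with this single monomial gives, which is the one-term case of `coeff-*`.
  data Quotient (x : Fin n) (ws : List (Fin n)) (y : Fin n) (ys : List (Fin n)) : Set (c ⊔ ℓ) where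
    divides     : ∀ k → (y , ys) ≡ ((x , ws) ·ₘ k) →
                  (∀ a g → conv (δᶜ a x ws) g y ys ≈ a * g (proj₁ k) (proj₂ k)) →
                  Quotient x ws y ys
    indivisible : (∀ k → ¬ ((y , ys) ≡ ((x , ws) ·ₘ k))) →
                  (∀ a g → conv (δᶜ a x ws) g y ys ≈ 0#) → Quotient x ws y ys

  -- The value at a one-letter monomial is a dummy; the map serves to strip the first letter from
  -- both sides of an equation between longer words.
  untail : Monomial n → Monomial n
  untail (x , [])     = x , []
  untail (x , w ∷ ws) = w , ws

  quotient : ∀ x ws y ys → Quotient x ws y ys
  quotient x []       y [] = indivisible (λ _ ()) (λ a g → refl)
  quotient x (w ∷ ws) y [] = indivisible (λ _ ()) (λ a g → refl)
  quotient x ws y (z ∷ zs) with y FinP.≟ x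
  quotient x ws y (z ∷ zs) | no ne = indivisible (λ k e → ne (≡.cong proj₁ e))
    λ a g → conv-head (δᶜ a x ws) g y (z ∷ zs) (δ-head a ws ne)
  quotient x [] x (z ∷ zs) | yes ≡.refl =
    divides (z , zs) ≡.refl λ a g → trans
      (+-cong (*-congʳ (δ-same a (x , [])))
              (conv-0ˡ g z zs (λ y ys → δ-other a (x , y ∷ ys) (x , []) λ ())))
      (+-identityʳ _)
  quotient x (w ∷ ws) x (z ∷ zs) | yes ≡.refl with quotient w ws z zs
  ... | divides k ≡.refl eq = divides k ≡.refl λ a g → trans
    (+-cong (trans (*-congʳ (δ-other a (x , []) (x , w ∷ ws) λ ())) (zeroˡ _))
            (conv-cong (shift-δ a x w ws) (λ _ _ → refl) z zs))
    (trans (+-identityˡ _) (eq a g))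
  ... | indivisible ne eq = indivisible (λ k e → ne k (≡.cong untail e)) λ a g → trans
    (+-cong (trans (*-congʳ (δ-other a (x , []) (x , w ∷ ws) λ ())) (zeroˡ _))
            (conv-cong (shift-δ a x w ws) (λ _ _ → refl) z zs))
    (trans (+-identityˡ _) (eq a g))

  scaled : Carrier → Monomial n → Elem → Elem
  scaled a m′ = map (λ bk → (a * proj₁ bk) , (m′ ·ₘ proj₂ bk))

  coeff-scaled-0 : ∀ a m′ q m → (∀ k → ¬ (m ≡ (m′ ·ₘ k))) → coeff (scaled a m′ q) m ≈ 0#
  coeff-scaled-0 a m′ []            m ne = refl
  coeff-scaled-0 a m′ ((b , k) ∷ q) m ne = trans (coeff-∷ _ _ (scaled a m′ q) m)
    (trans (+-cong (δ-other _ m (m′ ·ₘ k) (ne k)) (coeff-scaled-0 a m′ q m ne)) (+-identityˡ _))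

  ·ₘ-cancelˡ : ∀ m {k k′ : Monomial n} → (m ·ₘ k) ≡ (m ·ₘ k′) → k ≡ k′
  ·ₘ-cancelˡ (x , ws) {k} {k′} e
    with ≡.refl ← ListP.++-cancelˡ ws (proj₁ k ∷ proj₂ k) (proj₁ k′ ∷ proj₂ k′)
                    (≡.cong proj₂ e) = ≡.refl

  coeff-scaled : ∀ a m′ q k → coeff (scaled a m′ q) (m′ ·ₘ k) ≈ a * coeff q k
  coeff-scaled a m′ []             k = sym (zeroʳ a)
  coeff-scaled a m′ ((b , k′) ∷ q) k = begin
    coeff (scaled a m′ ((b , k′) ∷ q)) (m′ ·ₘ k)
      ≈⟨ coeff-∷ _ _ (scaled a m′ q) _ ⟩
    δ (a * b) (m′ ·ₘ k′) (m′ ·ₘ k) + coeff (scaled a m′ q) (m′ ·ₘ k)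
      ≈⟨ +-cong δ-scaled (coeff-scaled a m′ q k) ⟩
    a * δ b k′ k + a * coeff q k
      ≈⟨ sym (distribˡ a _ _) ⟩
    a * (δ b k′ k + coeff q k)
      ≈⟨ *-congˡ (sym (coeff-∷ b k′ q k)) ⟩
    a * coeff ((b , k′) ∷ q) k ∎
    where
    δ-scaled : δ (a * b) (m′ ·ₘ k′) (m′ ·ₘ k) ≈ a * δ b k′ k
    δ-scaled with k ≟ₘ k′
    ... | yes ≡.refl = δ-same (a * b) (m′ ·ₘ k)
    ... | no ne      = trans (δ-other (a * b) _ _ (λ e → ne (·ₘ-cancelˡ m′ e))) (sym (zeroʳ a))

  -- Both sides are additive in the left factor, so it is enough to treat one monomial, by the view
  -- `quotient`.
  coeff-* : ∀ p q → cf (p *ᴬ q) ≗ conv (cf p) (cf q)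
  coeff-* []                   q y ys = sym (conv-0ˡ (cf q) y ys (λ _ _ → refl))
  coeff-* ((a , (x , ws)) ∷ p) q y ys = begin
    coeff (scaled a (x , ws) q ++ p *ᴬ q) (y , ys)
      ≈⟨ coeff-+ (scaled a (x , ws) q) (p *ᴬ q) (y , ys) ⟩
    coeff (scaled a (x , ws) q) (y , ys) + coeff (p *ᴬ q) (y , ys)
      ≈⟨ +-cong first (coeff-* p q y ys) ⟩
    conv (δᶜ a x ws) (cf q) y ys + conv (cf p) (cf q) y ys
      ≈⟨ sym (conv-+ˡ (δᶜ a x ws) (cf p) (cf q) y ys) ⟩
    conv (λ z zs → δᶜ a x ws z zs + cf p z zs) (cf q) y ys
      ≈⟨ conv-cong (λ z zs → sym (coeff-∷ a (x , ws) p (z , zs))) (λ _ _ → refl) y ys ⟩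
    conv (cf ((a , (x , ws)) ∷ p)) (cf q) y ys ∎
    where
    first : coeff (scaled a (x , ws) q) (y , ys) ≈ conv (δᶜ a x ws) (cf q) y ys
    first with quotient x ws y ys
    ... | divides k ≡.refl eq = trans (coeff-scaled a (x , ws) q k) (sym (eq a (cf q)))
    ... | indivisible ne eq   =
      trans (coeff-scaled-0 a (x , ws) q (y , ys) ne) (sym (eq a (cf q)))

  +ᴬ-cong : ∀ {p p′ q q′} → p ≈ᴬ p′ → q ≈ᴬ q′ → (p +ᴬ q) ≈ᴬ (p′ +ᴬ q′)
  +ᴬ-cong {p} {p′} {q} {q′} e e′ m =
    trans (coeff-+ p q m) (trans (+-cong (e m) (e′ m)) (sym (coeff-+ p′ q′ m)))

  *ᴬ-cong : ∀ {p p′ q q′} → p ≈ᴬ p′ → q ≈ᴬ q′ → (p *ᴬ q) ≈ᴬ (p′ *ᴬ q′)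
  *ᴬ-cong {p} {p′} {q} {q′} e e′ (x , ws) = trans (coeff-* p q x ws) (trans
    (conv-cong (λ y ys → e (y , ys)) (λ y ys → e′ (y , ys)) x ws) (sym (coeff-* p′ q′ x ws)))

  *ᴬ-assoc : ∀ p q r → ((p *ᴬ q) *ᴬ r) ≈ᴬ (p *ᴬ (q *ᴬ r))
  *ᴬ-assoc p q r (x , ws) = begin
    cf ((p *ᴬ q) *ᴬ r) x ws                  ≈⟨ coeff-* (p *ᴬ q) r x ws ⟩
    conv (cf (p *ᴬ q)) (cf r) x ws           ≈⟨ conv-cong (coeff-* p q) (λ _ _ → refl) x ws ⟩
    conv (conv (cf p) (cf q)) (cf r) x ws    ≈⟨ conv-assoc (cf p) (cf q) (cf r) x ws ⟩
    conv (cf p) (conv (cf q) (cf r)) x ws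
      ≈⟨ conv-cong {f = cf p} (λ _ _ → refl) (λ y ys → sym (coeff-* q r y ys)) x ws ⟩
    conv (cf p) (cf (q *ᴬ r)) x ws           ≈⟨ sym (coeff-* p (q *ᴬ r) x ws) ⟩
    cf (p *ᴬ (q *ᴬ r)) x ws                  ∎

  *ᴬ-distribʳ : ∀ p q r → ((p +ᴬ q) *ᴬ r) ≈ᴬ ((p *ᴬ r) +ᴬ (q *ᴬ r))
  *ᴬ-distribʳ p q r (x , ws) = begin
    cf ((p +ᴬ q) *ᴬ r) x ws                      ≈⟨ coeff-* (p +ᴬ q) r x ws ⟩
    conv (cf (p +ᴬ q)) (cf r) x ws
      ≈⟨ conv-cong {f = cf (p +ᴬ q)} {g = cf r} (λ y ys → coeff-+ p q (y , ys)) (λ _ _ → refl) x ws ⟩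
    conv (λ y ys → cf p y ys + cf q y ys) (cf r) x ws
      ≈⟨ conv-+ˡ (cf p) (cf q) (cf r) x ws ⟩
    conv (cf p) (cf r) x ws + conv (cf q) (cf r) x ws
      ≈⟨ +-cong (sym (coeff-* p r x ws)) (sym (coeff-* q r x ws)) ⟩
    cf (p *ᴬ r) x ws + cf (q *ᴬ r) x ws          ≈⟨ sym (coeff-+ (p *ᴬ r) (q *ᴬ r) (x , ws)) ⟩
    cf ((p *ᴬ r) +ᴬ (q *ᴬ r)) x ws               ∎

  -- t ^1+ k is t^(k+1): the algebra has no unity.
  infixr 25 _^1+_
  _^1+_ : Elem → ℕ → Elem
  t ^1+ zero    = t
  t ^1+ (suc k) = t *ᴬ t ^1+ k

  ^1+-* : ∀ t i j → ((t ^1+ i) *ᴬ (t ^1+ j)) ≈ᴬ (t ^1+ suc (i ℕ.+ j))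
  ^1+-* t zero    j _ = refl
  ^1+-* t (suc i) j m = trans (*ᴬ-assoc t (t ^1+ i) (t ^1+ j) m)
    (*ᴬ-cong {t} {t} {t ^1+ i *ᴬ t ^1+ j} (λ _ → refl) (^1+-* t i j) m)

  *-low : ∀ p q d e → (∀ x ws → length ws < d → cf p x ws ≈ 0#) →
          (∀ x ws → length ws < e → cf q x ws ≈ 0#) →
          ∀ x ws → length ws ≤ d ℕ.+ e → cf (p *ᴬ q) x ws ≈ 0#
  *-low p q d e p≈0 q≈0 x ws lt =
    trans (coeff-* p q x ws) (conv-low (cf p) (cf q) d e p≈0 q≈0 x ws lt)

  ^1+-low : ∀ t k x ws → length ws < k → cf (t ^1+ k) x ws ≈ 0#
  ^1+-low t (suc k) x ws (s≤s lt) = *-low t (t ^1+ k) 0 k (λ _ _ ()) (^1+-low t k) x ws lt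

  -- _≈ᴬ_ is a function, so its arguments cannot be inferred; wrapped in a record they can.
  infix 4 _≋_
  record _≋_ (p q : Elem) : Set ℓ where
    constructor mk≋
    field at : p ≈ᴬ q
  open _≋_ public

  ≋-setoid : Setoid c ℓ
  ≋-setoid = record
    { Carrier = Elem
    ; _≈_ = _≋_
    ; isEquivalence = record
      { refl  = mk≋ λ _ → refl
      ; sym   = λ e → mk≋ λ m → sym (at e m)
      ; trans = λ e f → mk≋ λ m → trans (at e m) (at f m)
      }
    }
  open Setoid ≋-setoid public using ()
    renaming (refl to ≋-refl; sym to ≋-sym; trans to ≋-trans; reflexive to ≋-reflexive)

  +-cong≋ : ∀ {p p′ q q′} → p ≋ p′ → q ≋ q′ → (p +ᴬ q) ≋ (p′ +ᴬ q′)
  +-cong≋ {p} {p′} {q} {q′} e f = mk≋ (+ᴬ-cong {p} {p′} {q} {q′} (at e) (at f))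

  ·-cong : ∀ {p p′ q q′} → p ≋ p′ → q ≋ q′ → (p *ᴬ q) ≋ (p′ *ᴬ q′)
  ·-cong {p} {p′} {q} {q′} e f = mk≋ (*ᴬ-cong {p} {p′} {q} {q′} (at e) (at f))

  ·-congˡ : ∀ t {p q} → p ≋ q → (t *ᴬ p) ≋ (t *ᴬ q)
  ·-congˡ t = ·-cong (≋-refl {t})

  ·-congʳ : ∀ t {p q} → p ≋ q → (p *ᴬ t) ≋ (q *ᴬ t)
  ·-congʳ t e = ·-cong e (≋-refl {t})

  ·-assoc : ∀ p q r → ((p *ᴬ q) *ᴬ r) ≋ (p *ᴬ (q *ᴬ r))
  ·-assoc p q r = mk≋ (*ᴬ-assoc p q r)

  ·-distribʳ : ∀ p q r → ((p +ᴬ q) *ᴬ r) ≋ ((p *ᴬ r) +ᴬ (q *ᴬ r))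
  ·-distribʳ p q r = mk≋ (*ᴬ-distribʳ p q r)

  pow-cong : ∀ t {i j} → i ≡ j → t ^1+ i ≋ t ^1+ j
  pow-cong t e = ≋-reflexive (≡.cong (t ^1+_) e)

  pow-· : ∀ t i j → (t ^1+ i *ᴬ t ^1+ j) ≋ t ^1+ suc (i ℕ.+ j)
  pow-· t i j = mk≋ (^1+-* t i j)

  ^1+-·-low : ∀ t k p x ws → length ws < k → cf (t ^1+ k *ᴬ p) x ws ≈ 0#
  ^1+-·-low t k p x ws lt = *-low (t ^1+ k) p k 0 (^1+-low t k) (λ _ _ ()) x ws
    (ℕ.≤-trans (ℕ.<⇒≤ lt) (ℕ.m≤m+n k 0))

  degree-bound : ∀ p → ∃ λ N → ∀ x ws → N ≤ length ws → cf p x ws ≈ 0#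
  degree-bound [] = 0 , λ _ _ _ → refl
  degree-bound ((a , (y , ys)) ∷ p) with degree-bound p
  ... | N , p≈0 = suc (length ys) ℕ.⊔ N , λ x ws le → trans
    (coeff-∷ a (y , ys) p (x , ws)) (trans
    (+-cong (δ-other a (x , ws) (y , ys)
              λ { ≡.refl → ℕ.<⇒≱ (ℕ.n<1+n _) (ℕ.≤-trans (ℕ.m≤m⊔n _ N) le) })
            (p≈0 x ws (ℕ.≤-trans (ℕ.m≤n⊔m (suc (length ys)) N) le)))
    (+-identityˡ 0#))

  -- The bound is taken from the degree of `p` before `t` and `q` are given: a multiple of t^(N+1)
  -- has only terms of degree above those of `p`. In this form ⋂ Aᵏ = 0 applies to a `t` of unknown
  -- shape.
  deep-≋0 : ∀ p → ∃ λ N → ∀ t q → p ≋ t ^1+ N *ᴬ q → p ≋ 0ᴬ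
  deep-≋0 p with degree-bound p
  ... | N , high = N , λ t q e → mk≋ (λ (x , ws) → vanish t q e x ws (ℕ.<-≤-connex (length ws) N))
    where
    vanish : ∀ t q → p ≋ t ^1+ N *ᴬ q → ∀ x ws → length ws < N ⊎ N ≤ length ws → cf p x ws ≈ 0#
    vanish t q e x ws (inj₁ lt) = trans (at e (x , ws)) (^1+-·-low t N q x ws lt)
    vanish t q e x ws (inj₂ le) = high x ws le

  pow-suc : ∀ t k → t ^1+ suc k ≋ t ^1+ k *ᴬ t
  pow-suc t k = ≋-trans (pow-cong t (≡.cong suc (≡.sym (ℕ.+-identityʳ k)))) (≋-sym (pow-· t k 0))

  ·-distribˡ : ∀ p q r → (p *ᴬ (q +ᴬ r)) ≋ ((p *ᴬ q) +ᴬ (p *ᴬ r))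
  ·-distribˡ p q r = mk≋ λ (x , ws) → begin
    cf (p *ᴬ (q +ᴬ r)) x ws                      ≈⟨ coeff-* p (q +ᴬ r) x ws ⟩
    conv (cf p) (cf (q +ᴬ r)) x ws
      ≈⟨ conv-cong {f = cf p} {g = cf (q +ᴬ r)} (λ _ _ → refl) (λ y ys → coeff-+ q r (y , ys)) x ws ⟩
    conv (cf p) (λ y ys → cf q y ys + cf r y ys) x ws
      ≈⟨ conv-+ʳ (cf p) (cf q) (cf r) x ws ⟩
    conv (cf p) (cf q) x ws + conv (cf p) (cf r) x ws
      ≈⟨ +-cong (sym (coeff-* p q x ws)) (sym (coeff-* p r x ws)) ⟩
    cf (p *ᴬ q) x ws + cf (p *ᴬ r) x ws          ≈⟨ sym (coeff-+ (p *ᴬ q) (p *ᴬ r) (x , ws)) ⟩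
    cf ((p *ᴬ q) +ᴬ (p *ᴬ r)) x ws               ∎

  +-assoc≋ : ∀ p q r → ((p +ᴬ q) +ᴬ r) ≋ (p +ᴬ (q +ᴬ r))
  +-assoc≋ p q r = ≋-reflexive (ListP.++-assoc p q r)

  +-identityʳ≋ : ∀ p → (p +ᴬ 0ᴬ) ≋ p
  +-identityʳ≋ p = ≋-reflexive (ListP.++-identityʳ p)

below-suc : ∀ {p} {P : ℕ → Set p} {y} → (∀ z → z < y → P z) → P y → ∀ z → z < suc y → P z
below-suc below top z z<1+y with ℕ.m<1+n⇒m<n∨m≡n z<1+y
... | inj₁ z<y    = below z z<y
... | inj₂ ≡.refl = top

-- Reasoning under double negation.

module DoubleNegation where
  infixl 1 _>>=_
  _>>=_ : ∀ {a b} {A : Set a} {B : Set b} → ¬ ¬ A → (A → ¬ ¬ B) → ¬ ¬ B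
  (m >>= f) k = m (λ x → f x k)

  return : ∀ {a} {A : Set a} → A → ¬ ¬ A
  return x k = k x

  by-cases : ∀ {a} {A : Set a} → ¬ ¬ (A ⊎ ¬ A)
  by-cases k = k (inj₂ (λ x → k (inj₁ x)))

  ¬-stable : ∀ {a} {A : Set a} → ¬ ¬ ¬ A → ¬ A
  ¬-stable h x = h (λ n → n x)

-- Formulas defining arithmetic, good elements and recursive functions.

module _ {n : ℕ} where
  -- (t - 1) divides v - t, i.e. v has value 1 at t = 1.
  MonicF : Fin n → Fin n → Formula n
  MonicF t v = `∃ ((var (fsuc v) `+ var fzero) `≐ ((var fzero `· var (fsuc t)) `+ var (fsuc t)))

  CommuteF : Fin n → Fin n → Formula n
  CommuteF t v = (var v `· var t) `≐ (var t `· var v)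

  LeftFactorF : Fin n → Fin n → Formula n
  LeftFactorF v u = (var u `≐ var v) `∨ `∃ (var (fsuc u) `≐ (var (fsuc v) `· var fzero))

module _ {n : ℕ} where
  -- For t = x write a polynomial u as x^j f with f(0) ≠ 0 and f(1) = 1. Then x f equals or divides
  -- u, and it is not x times an element of the algebra, because f has a constant term. The last
  -- clause therefore forces x f = x, that is, f = 1.
  NumF : Fin n → Fin n → Formula n
  NumF t u = CommuteF t u `∧ (MonicF t u `∧ (((var u `≐ `0) `⇒ `⊥) `∧
    `∀ (CommuteF (fsuc t) fzero `⇒ (MonicF (fsuc t) fzero `⇒
      (LeftFactorF fzero (fsuc u) `⇒ LeftFactorF (fsuc t) fzero)))))

  -- For u = t^a and w = t^b: t^a - 1 divides t (t^b - 1), i.e. a divides b.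
  DividesF : Fin n → Term (suc n) → Term (suc n) → Formula n
  DividesF t u w =
    `∃ (((var (fsuc t) `· w) `+ var fzero) `≐ ((var fzero `· u) `+ var (fsuc t)))

module _ {n : ℕ} where
  -- The inequality is strict because every factor has a positive exponent.
  LessF : Fin n → Term (suc n) → Term (suc n) → Formula n
  LessF t u w = `∃ (NumF (fsuc t) fzero `∧ (w `≐ (u `· var fzero)))

module _ {n : ℕ} where
  -- With i = t^a, r = t^b and s = a + b, the pair is coded by v = s (s + 1) + a, where
  -- s (s + 1) is obtained as the least common multiple of s and s + 1; it belongs to the set
  -- (m , e , B) if v < B and v + e divides m (identifying powers of t with their exponents).
  MemberF : (t m e b i r : Fin n) → Formula n
  MemberF t m e b i r = `∃ (NumF (fsuc t) fzero `∧ (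
    DividesF (fsuc t) (w i `· w r) l `∧ (
    DividesF (fsuc t) (w t `· (w i `· w r)) l `∧ (
    `∀ (NumF (fsuc (fsuc t)) fzero `⇒ (
      DividesF (fsuc (fsuc t)) (w² i `· w² r) (var (fsuc fzero)) `⇒ (
      DividesF (fsuc (fsuc t)) (w² t `· (w² i `· w² r)) (var (fsuc fzero)) `⇒
      DividesF (fsuc (fsuc t)) (var (fsuc (fsuc fzero))) (var (fsuc fzero))))) `∧ (
    LessF (fsuc t) (l `· w i) (w b) `∧
    DividesF (fsuc t) ((l `· w i) `· w e) (w m))))))
    where
    w : Fin n → Term (suc (suc n))
    w x = var (fsuc (fsuc x))
    w² : Fin n → Term (suc (suc (suc n)))
    w² x = var (fsuc (fsuc (fsuc x)))
    l : Term (suc (suc n))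
    l = var (fsuc fzero)

GoodF : Formula 1
GoodF = base `∧ (closed `∧ (predecessor `∧ (empty-set `∧ adjoin)))
  where
  base = `∀ ((var fzero `≐ var (fsuc fzero)) `⇒ NumF (fsuc fzero) fzero)
  closed = `∀ (`∀ (NumF (fsuc (fsuc fzero)) (fsuc fzero) `⇒
    ((var fzero `≐ (var (fsuc (fsuc fzero)) `· var (fsuc fzero))) `⇒
      NumF (fsuc (fsuc fzero)) fzero)))
  predecessor = `∀ (NumF (fsuc fzero) fzero `⇒
    ((var fzero `≐ var (fsuc fzero)) `∨
     `∃ (NumF (fsuc (fsuc fzero)) fzero `∧
         (var (fsuc fzero) `≐ (var (fsuc (fsuc fzero)) `· var fzero)))))
  empty-set = `∃ (`∃ (`∃ (
    (NumF (# 3) (# 0) `∧ (NumF (# 3) (# 1) `∧ NumF (# 3) (# 2))) `∧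
    `∀ (`∀ (NumF (# 5) (# 1) `⇒ (NumF (# 5) (# 0) `⇒
      (MemberF (# 5) (# 4) (# 3) (# 2) (# 1) (# 0) `⇒ `⊥)))))))
  -- Under all ten binders `# 10` is t, `# 9` to `# 7` are the old triple, `# 6` and `# 5` the
  -- adjoined pair, `# 4` to `# 2` the new triple, and `# 1` and `# 0` the pair being tested.
  adjoin = `∀ (`∀ (`∀ (`∀ (`∀ (
    (NumF (# 5) (# 4) `∧ (NumF (# 5) (# 3) `∧ NumF (# 5) (# 2))) `⇒
    (NumF (# 5) (# 1) `⇒ (NumF (# 5) (# 0) `⇒
    `∃ (`∃ (`∃ (
      (NumF (# 8) (# 2) `∧ (NumF (# 8) (# 1) `∧ NumF (# 8) (# 0))) `∧
      `∀ (`∀ (NumF (# 10) (# 1) `⇒ (NumF (# 10) (# 0) `⇒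
        ((MemberF (# 10) (# 4) (# 3) (# 2) (# 1) (# 0) `⇒
           (MemberF (# 10) (# 9) (# 8) (# 7) (# 1) (# 0) `∨ new)) `∧
         ((MemberF (# 10) (# 9) (# 8) (# 7) (# 1) (# 0) `∨ new) `⇒
           MemberF (# 10) (# 4) (# 3) (# 2) (# 1) (# 0))))))))))))))))
    where
    new : Formula 11
    new = (var (# 1) `≐ var (# 6)) `∧ (var (# 0) `≐ var (# 5))

mutual
  -- If all variables denote powers of t, with t^(k+1) standing for the number k, then Γ g t xs y
  -- says that g has value y at xs.
  Γ : ∀ {k n} → PRec k → Fin n → List (Fin n) → Fin n → Formula n
  Γ zeroF t xs y = var y `≐ var t
  -- Argument lists carry no length; a list of the wrong length receives the false formula, and
  -- `Reps` excludes it.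
  Γ succF t [] y = `⊥
  Γ succF t (x ∷ xs) y = var y `≐ (var t `· var x)
  Γ (proj i) t xs y = var y `≐ var (nth t xs (toℕ i))
  Γ (comp f gs) t xs y = Γ* f gs t xs [] y
  -- Some finite set contains (x , y), and each of its pairs (i , r) is a value of f with i = 0 or
  -- comes from an earlier pair (i - 1 , r′) by g.
  Γ (prim f g) t [] y = `⊥
  Γ (prim f g) t (x ∷ xs) y = `∃ (`∃ (`∃ (
    MemberF (up 3 t) (fsuc (fsuc fzero)) (fsuc fzero) fzero (up 3 x) (up 3 y) `∧
    `∀ (`∀ (NumF (up 5 t) (fsuc fzero) `⇒ (NumF (up 5 t) fzero `⇒
      (MemberF (up 5 t) (fsuc (fsuc (fsuc (fsuc fzero)))) (fsuc (fsuc (fsuc fzero)))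
         (fsuc (fsuc fzero)) (fsuc fzero) fzero `⇒
      (((var (fsuc fzero) `≐ var (up 5 t)) `⇒ Γ f (up 5 t) (map (up 5) xs) fzero) `∧
       `∀ (NumF (up 6 t) fzero `⇒
         ((var (fsuc (fsuc fzero)) `≐ (var (up 6 t) `· var fzero)) `⇒
         `∃ (NumF (up 7 t) fzero `∧
           (MemberF (up 7 t) (up 2 (fsuc (fsuc (fsuc (fsuc fzero))))) (up 2 (fsuc (fsuc (fsuc fzero))))
              (up 2 (fsuc (fsuc fzero))) (fsuc fzero) fzero `∧
            Γ g (up 7 t) (fsuc fzero ∷ fzero ∷ map (up 7) xs) (up 2 fzero)))))))))))))
  -- As a value, t itself is the number 0. Below `y` the value is required to be t times a power of
  -- t, that is, a successor.
  Γ (mu f) t xs y = Γ f t (y ∷ xs) t `∧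
    `∀ (NumF (fsuc t) fzero `⇒ (LessF (fsuc t) (var (fsuc fzero)) (var (fsuc (fsuc y))) `⇒
      `∃ (NumF (up 2 t) fzero `∧ `∃ ((var fzero `≐ (var (up 3 t) `· var (fsuc fzero))) `∧
        Γ f (up 3 t) (up 2 fzero ∷ map (up 3) xs) fzero))))

  -- The inner values are named one at a time; `zs` collects their variables in order until `f` can
  -- be applied to them.
  Γ* : ∀ {k m p n} → PRec p → Vec (PRec k) m →
       Fin n → List (Fin n) → List (Fin n) → Fin n → Formula n
  Γ* f []       t xs zs y = Γ f t zs y
  Γ* f (g ∷ gs) t xs zs y = `∃ (NumF (fsuc t) fzero `∧
    (Γ g (fsuc t) (map fsuc xs) fzero `∧
     Γ* f gs (fsuc t) (map fsuc xs) (map fsuc zs ++ fzero ∷ []) (fsuc y)))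

  nth : ∀ {a} {A : Set a} → A → List A → ℕ → A
  nth d []       i       = d
  nth d (x ∷ xs) zero    = x
  nth d (x ∷ xs) (suc i) = nth d xs i

  -- Being a stack of constructors, it lets environments built with `extend` compute, so that old
  -- variables keep their values by `≡.refl`.
  up : ∀ {n} k → Fin n → Fin (k ℕ.+ n)
  up zero    i = i
  up (suc k) i = fsuc (up k i)

-- Arithmetic in the powers of an arbitrary good element.

module Numerals {c ℓ : Level} (K : Field c ℓ) (n : ℕ) where
  open FreeAlgebra K n
  open FreeAlgebraLaws K n
  open Semantics K n
  open DoubleNegation

  -- The environment chosen here is immaterial: unfolding `Sat` leaves only the values of the
  -- variables, so satisfaction in any other environment is the same type by computation.
  Num : Elem → Elem → Set (c ⊔ ℓ)
  Num t u = Sat (NumF (# 0) (# 1)) (lookup (t ∷ u ∷ []))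

  Member : (t m e b i r : Elem) → Set (c ⊔ ℓ)
  Member t m e b i r =
    Sat (MemberF (# 0) (# 1) (# 2) (# 3) (# 4) (# 5)) (lookup (t ∷ m ∷ e ∷ b ∷ i ∷ r ∷ []))

  Good : Elem → Set (c ⊔ ℓ)
  Good t = Sat GoodF (lookup (t ∷ []))

  -- This permits leaving double negation whenever the goal is the satisfaction of a formula.
  Sat-stable : ∀ {k} (φ : Formula k) ρ → ¬ ¬ Sat φ ρ → Sat φ ρ
  Sat-stable (s `≐ t) ρ h = λ k → h (λ x → x k)
  Sat-stable `⊥       ρ h = lift (h lower)
  Sat-stable (φ `∧ ψ) ρ h =
    Sat-stable φ ρ (λ k → h (λ x → k (proj₁ x))) , Sat-stable ψ ρ (λ k → h (λ x → k (proj₂ x)))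
  Sat-stable (φ `∨ ψ) ρ h = λ k → h (λ x → x k)
  Sat-stable (φ `⇒ ψ) ρ h = λ x → Sat-stable ψ ρ (λ k → h (λ f → k (f x)))
  Sat-stable (`∀ φ)   ρ h = λ a → Sat-stable φ _ (λ k → h (λ f → k (f a)))
  Sat-stable (`∃ φ)   ρ h = λ k → h (λ x → x k)

  ≐-intro : ∀ {p q} → p ≋ q → ¬ ¬ Lift c (p ≈ᴬ q)
  ≐-intro e k = k (lift (at e))

  ≐-elim : ∀ {p q} → ¬ ¬ Lift c (p ≈ᴬ q) → ¬ ¬ p ≋ q
  ≐-elim h k = h (λ e → k (mk≋ (lower e)))

  ∃-elim : ∀ {P : Elem → Set (c ⊔ ℓ)} → ¬ (∀ a → ¬ P a) → ¬ ¬ ∃ P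
  ∃-elim h k = h (λ a p → k (a , p))

  ∃-intro : ∀ {P : Elem → Set (c ⊔ ℓ)} a → P a → ¬ (∀ a → ¬ P a)
  ∃-intro a p k = k a p

  ∨-elim : ∀ {a b} {A : Set a} {B : Set b} → ¬ (¬ A × ¬ B) → ¬ ¬ (A ⊎ B)
  ∨-elim h k = h ((λ a → k (inj₁ a)) , (λ b → k (inj₂ b)))

  -- Everything that the representation of recursive functions uses about `t`. How a triple codes a
  -- set is hidden: only its members matter.
  record Arithmetic (t : Elem) : Set (c ⊔ ℓ) where
    field
      num⇒pow : ∀ {u} → Num t u → ¬ ¬ ∃ λ k → u ≋ t ^1+ k
      pow⇒num : ∀ {u} k → u ≋ t ^1+ k → Num t u
      pow-injective : ∀ i j → t ^1+ i ≋ t ^1+ j → i ≡ j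
      finite-set : ∀ (S : List (ℕ × ℕ)) → ¬ ¬ Σ (Elem × Elem × Elem) λ (m , e , b) →
        (∀ i r → Num t i → Num t r → Member t m e b i r →
           ¬ ¬ Σ (ℕ × ℕ) λ (k , y) → (k , y) ∈ S × i ≋ t ^1+ k × r ≋ t ^1+ y) ×
        (∀ i r k y → (k , y) ∈ S → i ≋ t ^1+ k → r ≋ t ^1+ y → Member t m e b i r)

  -- If `u` is no power of `t`, the descent never stops, so t^(k+1) divides `u` for every k and
  -- `deep-≋0` makes `u` zero. The predicate is abstract because the same argument serves good
  -- elements and the generator.
  descent : ∀ {a} (P : Elem → Set a) t →
    (∀ {u} → P u → ¬ (u ≋ 0ᴬ)) →
    (∀ {u} → P u → ¬ ¬ ((u ≋ t) ⊎ (∃ λ v → P v × u ≋ t *ᴬ v))) →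
    ∀ {u} → P u → ¬ ¬ ∃ λ k → u ≋ t ^1+ k
  descent P t nonzero predecessor {u} pu none = contradict (deep-≋0 u)
    where
    factor : ∀ k → ¬ ¬ ∃ λ v → P v × u ≋ t ^1+ k *ᴬ v
    factor zero = predecessor pu >>= λ where
      (inj₁ u≋t) → ⊥-elim (none (0 , u≋t))
      (inj₂ h)   → return h
    factor (suc k) = do
      v , pv , u≋tᵏv ← factor k
      predecessor pv >>= λ where
        (inj₁ v≋t) → ⊥-elim (none (suc k , ≋-trans u≋tᵏv (≋-trans (·-congˡ (t ^1+ k) v≋t)
          (≋-sym (pow-suc t k)))))
        (inj₂ (v′ , pv′ , v≋tv′)) → return (v′ , pv′ , ≋-trans u≋tᵏv
          (≋-trans (·-congˡ (t ^1+ k) v≋tv′)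
          (≋-trans (≋-sym (·-assoc (t ^1+ k) t v′)) (·-congʳ v′ (≋-sym (pow-suc t k))))))
    contradict : (∃ λ N → ∀ s q → u ≋ s ^1+ N *ᴬ q → u ≋ 0ᴬ) → ⊥
    contradict (N , zero-if) = factor N λ (v , _ , e) → nonzero pu (zero-if t v e)

  pow-+ : ∀ t x {i j} → t ^1+ i ≋ t ^1+ j → t ^1+ (x ℕ.+ i) ≋ t ^1+ (x ℕ.+ j)
  pow-+ t zero    e = e
  pow-+ t (suc x) e = ·-congˡ t (pow-+ t x e)

  pow-periodic : ∀ t i d → t ^1+ i ≋ t ^1+ (suc d ℕ.+ i) → ∀ N → t ^1+ i ≋ t ^1+ (N ℕ.* suc d ℕ.+ i)
  pow-periodic t i d e zero    = ≋-refl
  pow-periodic t i d e (suc N) = ≋-trans e (≋-trans (pow-+ t (suc d) (pow-periodic t i d e N))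
    (pow-cong t (≡.sym (ℕ.+-assoc (suc d) (N ℕ.* suc d) i))))

  -- A repetition can be iterated, which makes one power a multiple of arbitrarily high ones and
  -- hence zero by `deep-≋0`. The argument needs no degree of `t` and no cancellation.
  pow-aperiodic : ∀ t → (∀ k → ¬ (t ^1+ k ≋ 0ᴬ)) → ∀ i d → ¬ (t ^1+ i ≋ t ^1+ (suc d ℕ.+ i))
  pow-aperiodic t nonzero i d e = contradict (deep-≋0 (t ^1+ i))
    where
    open import Data.Nat.Solver using (module +-*-Solver)
    exponent : ∀ N → suc (N ℕ.+ (d ℕ.+ N ℕ.* d ℕ.+ i)) ≡ suc N ℕ.* suc d ℕ.+ i
    exponent N = solve 3 (λ N d i → con 1 :+ (N :+ (d :+ N :* d :+ i)) :=
      (con 1 :+ N) :* (con 1 :+ d) :+ i) ≡.refl N d i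
      where open +-*-Solver
    contradict : (∃ λ N → ∀ s q → t ^1+ i ≋ s ^1+ N *ᴬ q → t ^1+ i ≋ 0ᴬ) → ⊥
    -- With one period more than `N` the cofactor of t^(N+1) is a genuine power even when `d` and
    -- `i` are 0.
    contradict (N , zero-if) = nonzero i (zero-if t (t ^1+ (d ℕ.+ N ℕ.* d ℕ.+ i)) (≋-trans
      (pow-periodic t i d e (suc N)) (≋-trans (pow-cong t (≡.sym (exponent N)))
        (≋-sym (pow-· t N _)))))

  pow-<-≉ : ∀ t → (∀ k → ¬ (t ^1+ k ≋ 0ᴬ)) → ∀ i j → i < j → ¬ (t ^1+ i ≋ t ^1+ j)
  pow-<-≉ t nonzero i j i<j e = pow-aperiodic t nonzero i (j ℕ.∸ suc i) (≋-trans e (pow-cong t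
    (≡.trans (≡.sym (ℕ.m∸n+n≡m i<j)) (ℕ.+-suc (j ℕ.∸ suc i) i))))

  ^1+-injective : ∀ t → (∀ k → ¬ (t ^1+ k ≋ 0ᴬ)) → ∀ i j → t ^1+ i ≋ t ^1+ j → i ≡ j
  ^1+-injective t nonzero i j e with ℕ.<-cmp i j
  ... | tri≈ _ i≡j _ = i≡j
  ... | tri< i<j _ _ = ⊥-elim (pow-<-≉ t nonzero i j i<j e)
  ... | tri> _ _ j<i = ⊥-elim (pow-<-≉ t nonzero j i j<i (≋-sym e))

  module _ (t : Elem) where
    Triple : Elem → Elem → Elem → Set (c ⊔ ℓ)
    Triple m e b = Num t m × Num t e × Num t b

    -- These are the clauses of `GoodF` as they compute, so that passing to and from `Good` is mere
    -- tupling.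
    Base Closed Predecessor EmptySet Adjoin : Set (c ⊔ ℓ)
    Base = ∀ u → ¬ ¬ Lift c (u ≈ᴬ t) → Num t u
    Closed = ∀ u v → Num t u → ¬ ¬ Lift c (v ≈ᴬ (t *ᴬ u)) → Num t v
    Predecessor = ∀ u → Num t u →
      ¬ (¬ ¬ ¬ Lift c (u ≈ᴬ t) × ¬ ¬ (∀ v → ¬ (Num t v × ¬ ¬ Lift c (u ≈ᴬ (t *ᴬ v)))))
    EmptySet = ¬ (∀ m → ¬ ¬ (∀ e → ¬ ¬ (∀ b → ¬ ((Num t b × Num t e × Num t m) ×
      (∀ i r → Num t i → Num t r → Member t m e b i r → Lift (c ⊔ ℓ) ⊥)))))

    New : (i₀ r₀ i r : Elem) → Set (c ⊔ ℓ)
    New i₀ r₀ i r = (¬ ¬ Lift c (i ≈ᴬ i₀)) × (¬ ¬ Lift c (r ≈ᴬ r₀))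

    Adjoined : (m e b i₀ r₀ m′ e′ b′ : Elem) → Set (c ⊔ ℓ)
    Adjoined m e b i₀ r₀ m′ e′ b′ = ∀ i r → Num t i → Num t r →
      (Member t m′ e′ b′ i r → ¬ (¬ Member t m e b i r × ¬ New i₀ r₀ i r)) ×
      (¬ (¬ Member t m e b i r × ¬ New i₀ r₀ i r) → Member t m′ e′ b′ i r)

    Adjoin = ∀ m e b i₀ r₀ → Triple m e b → Num t i₀ → Num t r₀ →
      ¬ (∀ m′ → ¬ ¬ (∀ e′ → ¬ ¬ (∀ b′ → ¬ (Triple m′ e′ b′ × Adjoined m e b i₀ r₀ m′ e′ b′))))

  good-intro : ∀ {t} → Base t → Closed t → Predecessor t → EmptySet t → Adjoin t → Good t
  good-intro base closed predecessor empty-set adjoin =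
    base , closed , predecessor , empty-set , adjoin

  module _ {t : Elem} (good : Good t) where
    base : Base t
    base = proj₁ good

    closed : Closed t
    closed = proj₁ (proj₂ good)

    predecessor : Predecessor t
    predecessor = proj₁ (proj₂ (proj₂ good))

    empty-set : EmptySet t
    empty-set = proj₁ (proj₂ (proj₂ (proj₂ good)))

    adjoin : Adjoin t
    adjoin = proj₂ (proj₂ (proj₂ (proj₂ good)))

    num-≉0 : ∀ {u} → Num t u → ¬ (u ≋ 0ᴬ)
    num-≉0 num e = lower (proj₁ (proj₂ (proj₂ num)) (≐-intro e))

    num-suc : ∀ {u v} → Num t u → v ≋ (t *ᴬ u) → Num t v
    num-suc {u} {v} num e = closed u v num (≐-intro e)

    pow-num : ∀ k → Num t (t ^1+ k)
    pow-num zero    = base t (≐-intro (≋-refl {t}))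
    pow-num (suc k) = num-suc (pow-num k) ≋-refl

    good-num⇒pow : ∀ {u} → Num t u → ¬ ¬ ∃ λ k → u ≋ t ^1+ k
    good-num⇒pow = descent (Num t) t num-≉0 λ {u} num → ∨-elim (predecessor u num) >>= λ where
      (inj₁ h) → do
        u≋t ← ≐-elim h
        return (inj₁ u≋t)
      (inj₂ h) → do
        v , num-v , h ← ∃-elim h
        u≋tv ← ≐-elim h
        return (inj₂ (v , num-v , u≋tv))

    good-pow⇒num : ∀ {u} k → u ≋ t ^1+ k → Num t u
    good-pow⇒num zero    e = base _ (≐-intro e)
    good-pow⇒num (suc k) e = num-suc (pow-num k) e

    -- The induction also carries that the three components are numbers, since `Adjoin` asks this of
    -- the set to be enlarged.
    good-finite-set : ∀ (S : List (ℕ × ℕ)) → ¬ ¬ Σ (Elem × Elem × Elem) λ (m , e , b) →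
      ((Num t e × Num t m × Num t b) ×
       (∀ i r → Num t i → Num t r → Member t m e b i r →
         ¬ ¬ Σ (ℕ × ℕ) λ (k , y) → (k , y) ∈ S × i ≋ t ^1+ k × r ≋ t ^1+ y) ×
       (∀ i r k y → (k , y) ∈ S → i ≋ t ^1+ k → r ≋ t ^1+ y → Member t m e b i r))
    good-finite-set [] = do
      m , h ← ∃-elim empty-set
      e , h ← ∃-elim h
      b , (num-b , num-e , num-m) , none ← ∃-elim h
      return ((m , e , b) , ((num-e , num-m , num-b) ,
        (λ i r num-i num-r mem → ⊥-elim (lower (none i r num-i num-r mem))) , (λ _ _ _ _ ())))
    good-finite-set ((k₀ , y₀) ∷ S) = do
      (m , e , b) , (num-e , num-m , num-b) , only , all ← good-finite-set S
      let i₀ = t ^1+ k₀ ; r₀ = t ^1+ y₀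
      m′ , h ← ∃-elim (adjoin m e b i₀ r₀ (num-m , num-e , num-b) (pow-num k₀) (pow-num y₀))
      e′ , h ← ∃-elim h
      b′ , (num-m′ , num-e′ , num-b′) , h ← ∃-elim h
      return ((m′ , e′ , b′) , ((num-e′ , num-m′ , num-b′) ,
        (λ i r num-i num-r mem → ∨-elim (proj₁ (h i r num-i num-r) mem) >>= λ where
          (inj₁ old) → do
            ky , ky∈S , e₁ , e₂ ← only i r num-i num-r old
            return (ky , there ky∈S , e₁ , e₂)
          (inj₂ (new₁ , new₂)) → do
            e₁ ← ≐-elim new₁
            e₂ ← ≐-elim new₂
            return ((k₀ , y₀) , here ≡.refl , e₁ , e₂)) ,
        λ i r k y ky∈ i≋ r≋ → proj₂ (h i r (good-pow⇒num k i≋) (good-pow⇒num y r≋))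
          (λ (not-old , not-new) → member {m} {e} {b} all not-old not-new ky∈ i≋ r≋)))
      where
      member : ∀ {m e b i r k y} →
        (∀ i r k y → (k , y) ∈ S → i ≋ t ^1+ k → r ≋ t ^1+ y → Member t m e b i r) →
        ¬ Member t m e b i r → ¬ ((¬ ¬ Lift c (i ≈ᴬ (t ^1+ k₀))) × (¬ ¬ Lift c (r ≈ᴬ (t ^1+ y₀)))) →
        (k , y) ∈ (k₀ , y₀) ∷ S → i ≋ t ^1+ k → r ≋ t ^1+ y → ⊥
      member all not-old not-new (here ≡.refl) i≋ r≋ = not-new (≐-intro i≋ , ≐-intro r≋)
      member all not-old not-new (there ky∈S)  i≋ r≋ = not-old (all _ _ _ _ ky∈S i≋ r≋)

    arithmetic : Arithmetic t
    arithmetic = record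
      { num⇒pow = good-num⇒pow
      ; pow⇒num = good-pow⇒num
      ; pow-injective = ^1+-injective t (λ k → num-≉0 (pow-num k))
      ; finite-set = λ S → do
          meb , _ , h ← good-finite-set S
          return (meb , h)
      }

-- Recursive functions are represented in the powers of t.

module Representation {c ℓ : Level} (K : Field c ℓ) (n : ℕ) where
  open FreeAlgebra K n
  open FreeAlgebraLaws K n
  open Semantics K n
  open DoubleNegation
  open Numerals K n
  open Arithmetic

  Reps : ∀ {j} → (Fin j → Elem) → Elem → List (Fin j) → List ℕ → Set (c ⊔ ℓ)
  Reps ρ t []       []       = ⊤
  Reps ρ t []       (_ ∷ _)  = Lift (c ⊔ ℓ) ⊥
  Reps ρ t (_ ∷ _)  []       = Lift (c ⊔ ℓ) ⊥
  Reps ρ t (x ∷ xs) (k ∷ ks) = ρ x ≋ t ^1+ k × Reps ρ t xs ks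

  Reps-map : ∀ {j j′} {ρ : Fin j → Elem} {ρ′ : Fin j′ → Elem} {t} (w : Fin j → Fin j′) →
             (∀ v → ρ′ (w v) ≡ ρ v) → ∀ xs ks → Reps ρ t xs ks → Reps ρ′ t (map w xs) ks
  Reps-map w eq []       []       r       = r
  Reps-map w eq (x ∷ xs) (k ∷ ks) (e , r) =
    ≋-trans (≋-reflexive (eq x)) e , Reps-map w eq xs ks r

  Reps-snoc : ∀ {j} {ρ : Fin j → Elem} {t} xs ks {x k} →
              Reps ρ t xs ks → ρ x ≋ t ^1+ k → Reps ρ t (xs ++ x ∷ []) (ks ++ k ∷ [])
  Reps-snoc []       []       r       e′ = e′ , tt
  Reps-snoc (x ∷ xs) (k ∷ ks) (e , r) e′ = e , Reps-snoc xs ks r e′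

  Reps-nth : ∀ {j} {ρ : Fin j → Elem} {t} d xs {k} (ks : Vec ℕ k) i →
             Reps ρ t xs (toList ks) → ρ (nth d xs (toℕ i)) ≋ t ^1+ lookupV ks i
  Reps-nth d (x ∷ xs) (k ∷ ks) fzero    (e , r) = e
  Reps-nth d (x ∷ xs) (k ∷ ks) (fsuc i) (e , r) = Reps-nth d xs ks i r

  -- Double negation passes through a bounded quantifier by finitely many steps; `e-mu` wants all
  -- smaller arguments at once.
  ¬¬-below : ∀ {p} {P : ℕ → Set p} y → (∀ z → z < y → ¬ ¬ P z) → ¬ ¬ (∀ z → z < y → P z)
  ¬¬-below zero    h = return λ _ ()
  ¬¬-below (suc y) h = do
    below ← ¬¬-below y (λ z z<y → h z (ℕ.m<n⇒m<1+n z<y))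
    top ← h y (ℕ.n<1+n y)
    return (below-suc below top)

  mutual
    -- The induction is on the program, since that an evaluation exists is part of the conclusion.
    -- The value variable is assumed to be a number because under `mu` nothing else supplies the
    -- candidate value.
    sound : ∀ {k} (g : PRec k) {j} (ρ : Fin j → Elem) tv → Arithmetic (ρ tv) →
            ∀ xs ks yv → Reps ρ (ρ tv) xs (toList ks) → Num (ρ tv) (ρ yv) →
            Sat (Γ g tv xs yv) ρ → ¬ ¬ ∃ λ y → ρ yv ≋ ρ tv ^1+ y × Eval g ks y
    sound zeroF ρ tv ar xs ks yv reps num h = do
      e ← ≐-elim h
      return (0 , e , e-zero)
    sound succF ρ tv ar (x ∷ []) (k ∷ []) yv (x≋ , _) num h = do
      e ← ≐-elim h
      return (suc k , ≋-trans e (·-congˡ (ρ tv) x≋) , e-succ)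
    sound (proj i) ρ tv ar xs ks yv reps num h = do
      e ← ≐-elim h
      return (lookupV ks i , ≋-trans e (Reps-nth tv xs ks i reps) , e-proj)
    sound (comp f gs) ρ tv ar xs ks yv reps num h = do
      ys , evs , value ← sound* f gs ρ tv ar xs ks [] [] yv reps tt num h
      y , y≋ , ev ← value ys ≡.refl
      return (y , y≋ , e-comp evs ev)
    sound (prim f g) ρ tv ar (x ∷ xs) (k ∷ ks) yv (x≋ , reps) num h = do
      m , h ← ∃-elim h
      e , h ← ∃-elim h
      b , mem , just ← ∃-elim h
      sound-prim f g ρ tv ar xs ks reps m e b just k (ρ x) (ρ yv) x≋ num mem
    sound (mu f) ρ tv ar xs ks yv reps num (at-y , below-y) = do
      y , y≋ ← num⇒pow ar num
      -- The value variable is t, so the value found is the index of t among its own powers;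
      -- injectivity makes it 0.
      o , t≋ , ev ← sound f ρ tv ar (yv ∷ xs) (y ∷ ks) tv (y≋ , reps) (pow⇒num ar 0 ≋-refl) at-y
      below ← ¬¬-below y λ z z<y → do
        let t = ρ tv ; d = y ℕ.∸ suc z
        w , num-w , h ← ∃-elim (below-y (t ^1+ z) (pow⇒num ar z ≋-refl)
          (∃-intro (t ^1+ d) (pow⇒num ar d ≋-refl , ≐-intro
            (≋-trans y≋ (≋-trans (pow-cong t (≡.sym (ℕ.m+[n∸m]≡n z<y))) (≋-sym (pow-· t z d)))))))
        w′ , w′≐ , h ← ∃-elim h
        w′≋ ← ≐-elim w′≐
        i , w≋ ← num⇒pow ar num-w
        let w′≋pow = ≋-trans w′≋ (·-congˡ t w≋)
        v , w′≋v , ev ← sound f (extend w′ (extend w (extend (t ^1+ z) ρ))) (up 3 tv) ar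
          (up 2 fzero ∷ map (up 3) xs) (z ∷ ks) fzero
          (≋-refl , Reps-map (up 3) (λ _ → ≡.refl) xs (toList ks) reps)
          (pow⇒num ar (suc i) w′≋pow) h
        return (i , ≡.subst (Eval f (z ∷ ks))
          (pow-injective ar v (suc i) (≋-trans (≋-sym w′≋v) w′≋pow)) ev)
      return (y , y≋ , e-mu (≡.subst (Eval f (y ∷ ks))
        (pow-injective ar o 0 (≋-sym t≋)) ev) below)

    -- The arguments of `f` are an arbitrary vector with the right underlying list, which avoids
    -- transporting vectors along equations between lengths.
    sound* : ∀ {k m p} (f : PRec p) (gs : Vec (PRec k) m) {j} (ρ : Fin j → Elem) tv →
             Arithmetic (ρ tv) → ∀ xs ks zs as yv →
             Reps ρ (ρ tv) xs (toList ks) → Reps ρ (ρ tv) zs as → Num (ρ tv) (ρ yv) →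
             Sat (Γ* f gs tv xs zs yv) ρ →
             ¬ ¬ ∃ λ ys → EvalAll gs ks ys × (∀ ls → toList ls ≡ as ++ toList ys →
               ¬ ¬ ∃ λ y → ρ yv ≋ ρ tv ^1+ y × Eval f ls y)
    sound* f [] ρ tv ar xs ks zs as yv reps reps′ num h = return ([] , [] , λ ls eq →
      sound f ρ tv ar zs ls yv
        (≡.subst (Reps ρ (ρ tv) zs) (≡.sym (≡.trans eq (ListP.++-identityʳ as))) reps′) num h)
    sound* f (g ∷ gs) ρ tv ar xs ks zs as yv reps reps′ num h = do
      a , num-a , h , rest ← ∃-elim h
      let reps₁ = Reps-map {ρ′ = extend a ρ} fsuc (λ _ → ≡.refl) xs (toList ks) reps
      y , a≋ , ev ← sound g (extend a ρ) (fsuc tv) ar (map fsuc xs) ks fzero reps₁ num-a h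
      ys , evs , value ← sound* f gs (extend a ρ) (fsuc tv) ar (map fsuc xs) ks
        (map fsuc zs ++ fzero ∷ []) (as ++ y ∷ []) (fsuc yv) reps₁
        (Reps-snoc (map fsuc zs) as (Reps-map fsuc (λ _ → ≡.refl) zs as reps′) a≋) num rest
      return (y ∷ ys , ev ∷ evs , λ ls eq → value ls
        (≡.trans eq (≡.sym (ListP.++-assoc as (y ∷ []) (toList ys)))))

    -- Induction on `x`: justifications lead from a pair down to one with first component 0. Nothing
    -- is asked of `m`, `e`, `b` beyond justified members, so any witness satisfying the formula
    -- forces correct values.
    sound-prim : ∀ {k} (f : PRec k) (g : PRec (suc (suc k))) {j} (ρ : Fin j → Elem) tv →
      Arithmetic (ρ tv) → ∀ xs ks → Reps ρ (ρ tv) xs (toList ks) → ∀ m e b →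
      (∀ i r → Num (ρ tv) i → Num (ρ tv) r → Member (ρ tv) m e b i r →
        (¬ ¬ Lift c (i ≈ᴬ ρ tv) →
          Sat (Γ f (up 5 tv) (map (up 5) xs) fzero)
            (extend r (extend i (extend b (extend e (extend m ρ)))))) ×
        (∀ i′ → Num (ρ tv) i′ → ¬ ¬ Lift c (i ≈ᴬ (ρ tv *ᴬ i′)) →
          ¬ (∀ r′ → ¬ (Num (ρ tv) r′ × Member (ρ tv) m e b i′ r′ ×
            Sat (Γ g (up 7 tv) (fsuc fzero ∷ fzero ∷ map (up 7) xs) (up 2 fzero))
              (extend r′ (extend i′ (extend r (extend i (extend b (extend e (extend m ρ))))))))))) →
      ∀ x i r → i ≋ ρ tv ^1+ x → Num (ρ tv) r → Member (ρ tv) m e b i r →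
      ¬ ¬ ∃ λ y → r ≋ ρ tv ^1+ y × Eval (prim f g) (x ∷ ks) y
    sound-prim f g ρ tv ar xs ks reps m e b just zero i r i≋ num-r mem = do
      y , r≋ , ev ← sound f (extend r (extend i (extend b (extend e (extend m ρ))))) (up 5 tv) ar
        (map (up 5) xs) ks fzero (Reps-map (up 5) (λ _ → ≡.refl) xs (toList ks) reps) num-r
        (proj₁ (just i r (pow⇒num ar 0 i≋) num-r mem) (≐-intro i≋))
      return (y , r≋ , e-prim0 ev)
    sound-prim f g ρ tv ar xs ks reps m e b just (suc x) i r i≋ num-r mem = do
      let i′ = ρ tv ^1+ x
      r′ , num-r′ , mem′ , h ← ∃-elim (proj₂ (just i r (pow⇒num ar (suc x) i≋) num-r mem)
        i′ (pow⇒num ar x ≋-refl) (≐-intro i≋))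
      y′ , r′≋ , ev′ ← sound-prim f g ρ tv ar xs ks reps m e b just x i′ r′ ≋-refl num-r′ mem′
      y , r≋ , ev ← sound g
        (extend r′ (extend i′ (extend r (extend i (extend b (extend e (extend m ρ))))))) (up 7 tv) ar
        (fsuc fzero ∷ fzero ∷ map (up 7) xs) (x ∷ y′ ∷ ks) (up 2 fzero)
        (≋-refl , r′≋ , Reps-map (up 7) (λ _ → ≡.refl) xs (toList ks) reps) num-r h
      return (y , r≋ , e-primS ev′ ev)

  Holds : ∀ {k} → PRec k → List ℕ → ℕ → Set (c ⊔ ℓ)
  Holds g ks y = ∀ {j} (ρ : Fin j → Elem) tv → Arithmetic (ρ tv) → ∀ xs yv →
    Reps ρ (ρ tv) xs ks → ρ yv ≋ ρ tv ^1+ y → Sat (Γ g tv xs yv) ρ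

  -- It stores `Holds` and not evaluations, so that `complete` is only ever called on subderivations
  -- and the recursion is structural.
  Justified : ∀ {k} → PRec k → PRec (suc (suc k)) → List ℕ → List (ℕ × ℕ) → ℕ × ℕ → Set (c ⊔ ℓ)
  Justified f g ks S (zero  , y) = Holds f ks y
  Justified f g ks S (suc x , y) = ∃ λ y′ → (x , y′) ∈ S × Holds g (x ∷ y′ ∷ ks) y

  Justified-∷ : ∀ {k} {f : PRec k} {g ks S s} p → Justified f g ks S p → Justified f g ks (s ∷ S) p
  Justified-∷ (zero  , y) h              = h
  Justified-∷ (suc x , y) (y′ , p∈S , h) = y′ , there p∈S , h

  Trace : ∀ {k} → PRec k → PRec (suc (suc k)) → List ℕ → ℕ × ℕ → Set (c ⊔ ℓ)
  Trace f g ks p = Σ (List (ℕ × ℕ)) λ S → p ∈ S × (∀ q → q ∈ S → Justified f g ks S q)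

  prim-complete : ∀ {k} (f : PRec k) (g : PRec (suc (suc k))) ks x y →
                  Trace f g ks (x , y) → Holds (prim f g) (x ∷ ks) y
  prim-complete f g ks x y (S , p∈S , just) ρ tv ar (xv ∷ xs) yv (x≋ , reps) y≋ = ¬-stable do
    (m , e , b) , only , all ← finite-set ar S
    return (∃-intro m (∃-intro e (∃-intro b (all (ρ xv) (ρ yv) x y p∈S x≋ y≋ ,
      λ i r num-i num-r mem → (λ i≐t →
        Sat-stable (Γ f (up 5 tv) (map (up 5) xs) fzero)
          (extend r (extend i (extend b (extend e (extend m ρ))))) (do
            q , q∈S , i≋ , r≋ ← only i r num-i num-r mem
            i≋t ← ≐-elim i≐t
            return (initial m e b i r q q∈S i≋ r≋ i≋t))) ,
      λ i′ num-i′ i≐ → ¬-stable (do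
        q , q∈S , i≋ , r≋ ← only i r num-i num-r mem
        i≋ti′ ← ≐-elim i≐
        x′ , i′≋ ← num⇒pow ar num-i′
        let y′ , p′∈S , h = successor q x′ q∈S
              (pow-injective ar _ _ (≋-trans (≋-sym i≋) (≋-trans i≋ti′ (·-congˡ (ρ tv) i′≋))))
            r′ = ρ tv ^1+ y′
        return (∃-intro r′ (pow⇒num ar y′ ≋-refl , all i′ r′ x′ y′ p′∈S i′≋ ≋-refl ,
          h (extend r′ (extend i′ (extend r (extend i (extend b (extend e (extend m ρ)))))))
            (up 7 tv) ar (fsuc fzero ∷ fzero ∷ map (up 7) xs) (up 2 fzero)
            (i′≋ , ≋-refl , Reps-map (up 7) (λ _ → ≡.refl) xs ks reps) r≋)))))))
    where
    initial : ∀ m e b i r q → q ∈ S → i ≋ ρ tv ^1+ proj₁ q → r ≋ ρ tv ^1+ proj₂ q → i ≋ ρ tv →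
      Sat (Γ f (up 5 tv) (map (up 5) xs) fzero) (extend r (extend i (extend b (extend e (extend m ρ)))))
    initial m e b i r (zero , y) q∈S i≋ r≋ i≋t =
      just (zero , y) q∈S (extend r (extend i (extend b (extend e (extend m ρ))))) (up 5 tv) ar
        (map (up 5) xs) fzero (Reps-map (up 5) (λ _ → ≡.refl) xs ks reps) r≋
    initial m e b i r (suc x , y) q∈S i≋ r≋ i≋t
      with () ← pow-injective ar (suc x) 0 (≋-trans (≋-sym i≋) i≋t)

    successor : ∀ q x′ → q ∈ S → proj₁ q ≡ suc x′ →
      ∃ λ y′ → (x′ , y′) ∈ S × Holds g (x′ ∷ y′ ∷ ks) (proj₂ q)
    successor (suc x′ , y) x′ q∈S ≡.refl = just (suc x′ , y) q∈S

  mutual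
    complete : ∀ {k} {g : PRec k} {ks y} → Eval g ks y → Holds g (toList ks) y
    complete e-zero ρ tv ar xs yv reps y≋ = ≐-intro y≋
    complete e-succ ρ tv ar (x ∷ []) yv (x≋ , _) y≋ =
      ≐-intro (≋-trans y≋ (·-congˡ (ρ tv) (≋-sym x≋)))
    complete (e-proj {i = i} {ks}) ρ tv ar xs yv reps y≋ =
      ≐-intro (≋-trans y≋ (≋-sym (Reps-nth tv xs ks i reps)))
    complete {y = y} (e-comp evs ev) ρ tv ar xs yv reps y≋ =
      complete* {y = y} evs [] (complete ev) ρ tv ar xs [] yv reps tt y≋
    complete {ks = k ∷ ks} (e-prim0 ev) =
      prim-complete _ _ (toList ks) k _ (trace (e-prim0 ev))
    complete {ks = k ∷ ks} (e-primS ev ev′) =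
      prim-complete _ _ (toList ks) k _ (trace (e-primS ev ev′))
    complete {ks = ks} (e-mu {f = f} {y = y} ev below) ρ tv ar xs yv reps y≋ =
      complete ev ρ tv ar (yv ∷ xs) tv (y≋ , reps) ≋-refl ,
      λ a num-a a<y → ¬-stable (do
        z , a≋ ← num⇒pow ar num-a
        w , num-w , y≐ ← ∃-elim a<y
        d , w≋ ← num⇒pow ar num-w
        y≋aw ← ≐-elim y≐
        let t = ρ tv
            z<y = ≡.subst (z <_) (≡.sym (pow-injective ar y (suc (z ℕ.+ d)) (≋-trans (≋-sym y≋)
              (≋-trans y≋aw (≋-trans (·-cong a≋ w≋) (pow-· t z d)))))) (s≤s (ℕ.m≤m+n z d))
            v , h = complete-suc (below z z<y)
        return (∃-intro (t ^1+ v) (pow⇒num ar v ≋-refl , ∃-intro (t ^1+ suc v)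
          (≐-intro (≋-refl {t ^1+ suc v}) ,
          h (extend (t ^1+ suc v) (extend (t ^1+ v) (extend a ρ))) (up 3 tv) ar
            (up 2 fzero ∷ map (up 3) xs) fzero
            (a≋ , Reps-map (up 3) (λ _ → ≡.refl) xs (toList ks) reps) ≋-refl))))

    complete-suc : ∀ {k} {g : PRec k} {ks} → (∃ λ w → Eval g ks (suc w)) →
                   ∃ λ w → Holds g (toList ks) (suc w)
    complete-suc (w , ev) = w , complete ev

    complete* : ∀ {k m p} {f : PRec p} {gs : Vec (PRec k) m} {ks ys y} → EvalAll gs ks ys →
      ∀ as → Holds f (as ++ toList ys) y →
      ∀ {j} (ρ : Fin j → Elem) tv → Arithmetic (ρ tv) → ∀ xs zs yv →
      Reps ρ (ρ tv) xs (toList ks) → Reps ρ (ρ tv) zs as → ρ yv ≋ ρ tv ^1+ y →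
      Sat (Γ* f gs tv xs zs yv) ρ
    complete* [] as h ρ tv ar xs zs yv reps reps′ y≋ = h ρ tv ar zs yv
      (≡.subst (Reps ρ (ρ tv) zs) (≡.sym (ListP.++-identityʳ as)) reps′) y≋
    complete* {f = f} {ks = ks} {y = y} (_∷_ {y = b} {ys = ys} ev evs) as h
              ρ tv ar xs zs yv reps reps′ y≋ =
      ∃-intro a (pow⇒num ar b ≋-refl ,
        complete ev (extend a ρ) (fsuc tv) ar (map fsuc xs) fzero reps₁ ≋-refl ,
        complete* {y = y} evs (as ++ b ∷ [])
          (≡.subst (λ l → Holds f l y) (≡.sym (ListP.++-assoc as (b ∷ []) (toList ys))) h)
          (extend a ρ) (fsuc tv) ar (map fsuc xs) (map fsuc zs ++ fzero ∷ []) (fsuc yv) reps₁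
          (Reps-snoc (map fsuc zs) as (Reps-map fsuc (λ _ → ≡.refl) zs as reps′) ≋-refl) y≋)
      where
      a = ρ tv ^1+ b
      reps₁ = Reps-map {ρ′ = extend a ρ} fsuc (λ _ → ≡.refl) xs (toList ks) reps

    trace : ∀ {k} {f : PRec k} {g x ks y} → Eval (prim f g) (x ∷ ks) y → Trace f g (toList ks) (x , y)
    trace (e-prim0 {y = y} ev) = (0 , y) ∷ [] , here ≡.refl , λ { _ (here ≡.refl) → complete ev }
    trace {f = f} {g} {ks = ks} (e-primS {x = x} {r = r} {y = y} ev ev′) with trace ev
    ... | S , p∈S , just = (suc x , y) ∷ S , here ≡.refl , λ where
      _ (here ≡.refl) → r , there p∈S , complete ev′
      q (there q∈S)   → Justified-∷ {f = f} {g} {toList ks} q (just q q∈S)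

-- The undefinability argument.

module _ where
  open Computability

  -- Here `P` is the truth of the sentence with code `d` and amounts to f(d) = 0. No case
  -- distinction is made: truth would give f(d) both values 0 and 1, so `P` fails; then f(d) = 0,
  -- and `P` holds after all.
  liar : ∀ {a} {P : Set a} (diag f : PRec 1) x d → Eval diag (x ∷ []) d →
    (P → ¬ ¬ Eval (comp f (diag ∷ [])) (x ∷ []) 0) → (Eval (comp f (diag ∷ [])) (x ∷ []) 0 → P) →
    (P → Eval f (d ∷ []) 1) → (¬ P → Eval f (d ∷ []) 0) → ⊥
  liar {P = P} diag f x d diag-x represents⇒ represents⇐ accepts rejects =
    false (represents⇐ (e-comp (diag-x ∷ []) (rejects false)))
    where
    clash : P → ¬ Eval (comp f (diag ∷ [])) (x ∷ []) 0
    clash p (e-comp (dv ∷ []) fv)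
      with ≡.refl ← Eval-functional dv diag-x
      with () ← Eval-functional fv (accepts p)
    false : ¬ P
    false p = represents⇒ p (clash p)

  tarski : ∀ {a} (T : Sentence → Set a) (γ : Formula 1) (Φ : PRec 1 → Formula 2) →
    (∀ h x → T (diagonal γ (Φ h) x) → ¬ ¬ Eval h (x ∷ []) 0) →
    (∀ h x → Eval h (x ∷ []) 0 → T (diagonal γ (Φ h) x)) →
    ¬ DecidableSet (λ x → Σ Sentence λ φ → (⌜ φ ⌝ ≡ x) × T φ)
  tarski T γ Φ represents⇒ represents⇐ (f , decides) =
    liar (diagonalF ⌜ γ ⌝) f ⌜ Φ h ⌝ ⌜ D ⌝ (diagonalF-eval γ (Φ h))
      (represents⇒ h ⌜ Φ h ⌝) (represents⇐ h ⌜ Φ h ⌝)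
      (λ td → proj₁ (decides ⌜ D ⌝) (D , ≡.refl , td))
      -- Codes are injective, so a true sentence with the code of `D` would be `D`.
      (λ ¬td → proj₂ (decides ⌜ D ⌝) λ (ψ , eq , tψ) → ¬td (≡.subst T (⌜⌝-injective ψ D eq) tψ))
    where
    h : PRec 1
    h = comp f (diagonalF ⌜ γ ⌝ ∷ [])
    D : Sentence
    D = diagonal γ (Φ h) ⌜ Φ h ⌝

module _ {c ℓ : Level} (K : Field c ℓ) (n : ℕ) where
  open Computability using (powerTerm; diagonal)
  open FreeAlgebra K n
  open FreeAlgebraLaws K n
  open Semantics K n
  open DoubleNegation
  open Numerals K n
  open Arithmetic
  open Representation K n

  ⟦powerTerm⟧ : ∀ {j} (ρ : Fin j → Elem) t x → ⟦ powerTerm t x ⟧ₜ ρ ≡ ρ t ^1+ x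
  ⟦powerTerm⟧ ρ t zero    = ≡.refl
  ⟦powerTerm⟧ ρ t (suc x) = ≡.cong (ρ t *ᴬ_) (⟦powerTerm⟧ ρ t x)

  -- Variable 1 is both the base t and, as value, the number 0.
  zeroAt : PRec 1 → Formula 2
  zeroAt h = Γ h (fsuc fzero) (fzero ∷ []) (fsuc fzero)

  good⇒undecidable : ∀ t → Good t → TheoryUndecidable K n
  good⇒undecidable t good = tarski True GoodF zeroAt
    (λ h x td → do
      -- This t comes from the sentence and may differ from the given one, whence the need for
      -- soundness at every good element.
      t , good , td ← ∃-elim td
      v , v≐ , sat ← ∃-elim td
      v≋ ← ≐-elim v≐
      let ρ = extend v (extend t empty)
          ar = arithmetic good
      y , t≋ , ev ← sound h ρ (fsuc fzero) ar (fzero ∷ []) (x ∷ []) (fsuc fzero)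
        (≋-trans v≋ (≋-reflexive (⟦powerTerm⟧ ρ (fsuc fzero) x)) , tt) (pow⇒num ar 0 ≋-refl) sat
      return (≡.subst (Eval h (x ∷ [])) (≡.sym (pow-injective ar 0 y t≋)) ev))
    (λ h x ev → let v = t ^1+ x ; ρ = extend v (extend t empty) in
      ∃-intro t (good , ∃-intro v (≐-intro (≋-sym (≋-reflexive (⟦powerTerm⟧ ρ (fsuc fzero) x))) ,
        complete ev ρ (fsuc fzero) (arithmetic good) (fzero ∷ []) (fsuc fzero) (≋-refl , tt) ≋-refl)))

-- Coding finite sets of natural numbers by divisibility.

module FiniteSetCoding where
  open import Data.Nat using (_+_; _*_; _^_; ∣_-_∣; >-nonZero)
  open import Data.Nat.Divisibility
  open import Data.Nat.ListAction using (product)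
  open import Data.Nat.Solver using (module +-*-Solver)
  open import Data.List using (filter; upTo)
  open import Data.List.Membership.Propositional.Properties
    using (∈-filter⁺; ∈-filter⁻; ∈-upTo⁺; ∈-upTo⁻)
  open import Data.List.Membership.DecPropositional ℕ._≟_ using (_∈?_)
  open import Function using (_∘_)
  open import Relation.Binary.PropositionalEquality using (sym; trans; cong; subst)

  -- For s = a + b consecutive values of s (s + 1) are 2 (s + 1) apart, more than a ≤ s, which gives
  -- injectivity.
  code : ℕ → ℕ → ℕ
  code a b = (a + b) * suc (a + b) + a

  code-< : ∀ {a b a′ b′} → a + b < a′ + b′ → code a b < code a′ b′
  code-< {a} {b} {a′} {b′} lt = begin-strict
    s * suc s + a         ≤⟨ ℕ.+-monoʳ-≤ (s * suc s) (ℕ.m≤m+n a b) ⟩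
    s * suc s + s         ≡⟨ ℕ.+-comm (s * suc s) s ⟩
    s + s * suc s         <⟨ ℕ.n<1+n _ ⟩
    suc s * suc s         ≤⟨ ℕ.*-mono-≤ lt (ℕ.m≤n⇒m≤1+n lt) ⟩
    s′ * suc s′           ≤⟨ ℕ.m≤m+n (s′ * suc s′) a′ ⟩
    s′ * suc s′ + a′      ∎
    where
    open ℕ.≤-Reasoning
    s = a + b
    s′ = a′ + b′

  code-injective : ∀ {a b a′ b′} → code a b ≡ code a′ b′ → a ≡ a′ × b ≡ b′
  code-injective {a} {b} {a′} {b′} eq with ℕ.<-cmp (a + b) (a′ + b′)
  ... | tri< lt _ _ = ⊥-elim (ℕ.<⇒≢ (code-< {a} {b} {a′} {b′} lt) eq)
  ... | tri> _ _ gt = ⊥-elim (ℕ.<⇒≢ (code-< {a′} {b′} {a} {b} gt) (sym eq))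
  ... | tri≈ _ s _  = a≡a′ , ℕ.+-cancelˡ-≡ a b b′ (trans s (cong (_+ b′) (sym a≡a′)))
    where
    a≡a′ : a ≡ a′
    a≡a′ = ℕ.+-cancelˡ-≡ ((a + b) * suc (a + b)) a a′
      (trans eq (cong (λ s → s * suc s + a′) (sym s)))

  -- v + e is congruent to ± (v - w) modulo w + e.
  replace-factor : ∀ e v w X → (w + e) ∣ (v + e) * X → (w + e) ∣ ∣ v - w ∣ * X
  replace-factor e v w X d with ℕ.≤-total w v
  ... | inj₁ w≤v rewrite ℕ.m≤n⇒∣n-m∣≡n∸m w≤v =
    ∣m+n∣m⇒∣n (subst ((w + e) ∣_) split d) (m∣m*n X)
    where
    split : (v + e) * X ≡ (w + e) * X + (v ℕ.∸ w) * X
    split = trans (cong (λ k → (k + e) * X) (sym (ℕ.m+[n∸m]≡n w≤v)))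
      (solve 4 (λ w d e X → (w :+ d :+ e) :* X := (w :+ e) :* X :+ d :* X) ≡.refl w (v ℕ.∸ w) e X)
      where open +-*-Solver
  ... | inj₂ v≤w rewrite ℕ.m≤n⇒∣m-n∣≡n∸m v≤w =
    ∣m+n∣m⇒∣n (subst ((w + e) ∣_) split (m∣m*n X)) d
    where
    split : (w + e) * X ≡ (v + e) * X + (w ℕ.∸ v) * X
    split = trans (cong (λ k → (k + e) * X) (sym (ℕ.m+[n∸m]≡n v≤w)))
      (solve 4 (λ v d e X → (v :+ d :+ e) :* X := (v :+ e) :* X :+ d :* X) ≡.refl v (w ℕ.∸ v) e X)
      where open +-*-Solver

  differences : List ℕ → ℕ → ℕ
  differences S w = product (map (λ v → ∣ v - w ∣) S)

  shifted : List ℕ → ℕ → ℕ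
  shifted S e = product (map (_+ e) S)

  -- The cofactor `Y` collects the differences that have already replaced their factors, so that the
  -- factors can be exchanged one at a time.
  divides-differences : ∀ e w S Y → (w + e) ∣ shifted S e * Y → (w + e) ∣ differences S w * Y
  divides-differences e w []      Y d = d
  divides-differences e w (v ∷ S) Y d =
    subst ((w + e) ∣_) (regroup (differences S w) ∣ v - w ∣ Y)
      (divides-differences e w S (∣ v - w ∣ * Y)
        (subst ((w + e) ∣_) (reorder ∣ v - w ∣ (shifted S e) Y)
          (replace-factor e v w (shifted S e * Y)
            (subst ((w + e) ∣_) (ℕ.*-assoc (v + e) (shifted S e) Y) d))))
    where
    open +-*-Solver
    reorder : ∀ a b c → a * (b * c) ≡ b * (a * c)
    reorder = solve 3 (λ a b c → a :* (b :* c) := b :* (a :* c)) ≡.refl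
    regroup : ∀ a b c → a * (b * c) ≡ b * a * c
    regroup = solve 3 (λ a b c → a :* (b :* c) := b :* a :* c) ≡.refl

  differences-bounded : ∀ B S w → w < B → (∀ {v} → v ∈ S → v < B) → differences S w ≤ B ^ length S
  differences-bounded B []      w w<B S<B = s≤s z≤n
  differences-bounded B (v ∷ S) w w<B S<B = ℕ.*-mono-≤
    (ℕ.≤-trans (ℕ.∣m-n∣≤m⊔n v w) (ℕ.⊔-lub (ℕ.<⇒≤ (S<B (here ≡.refl))) (ℕ.<⇒≤ w<B)))
    (differences-bounded B S w w<B (S<B ∘ there))

  differences-positive : ∀ S w → ¬ w ∈ S → 0 < differences S w
  differences-positive []      w w∉S = s≤s z≤n
  differences-positive (v ∷ S) w w∉S = ℕ.*-mono-≤
    (ℕ.n≢0⇒n>0 (λ e → w∉S (here (sym (ℕ.∣m-n∣≡0⇒m≡n e)))))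
    (differences-positive S w (w∉S ∘ there))

  shifted-positive : ∀ S e → 0 < shifted S (suc e)
  shifted-positive []      e = s≤s z≤n
  shifted-positive (v ∷ S) e = ℕ.*-mono-≤ (ℕ.≤-trans (s≤s z≤n) (ℕ.m≤n+m (suc e) v)) (shifted-positive S e)

  ∈⇒∣shifted : ∀ {v S} e → v ∈ S → (v + e) ∣ shifted S e
  ∈⇒∣shifted {S = _ ∷ S} e (here ≡.refl) = m∣m*n (shifted S e)
  ∈⇒∣shifted {S = u ∷ S} e (there v∈S)   = ∣n⇒∣m*n (u + e) (∈⇒∣shifted e v∈S)

  ∣shifted⇒∈ : ∀ B S w → w < B → (∀ {v} → v ∈ S → v < B) →
    (w + suc (B ^ length S)) ∣ shifted S (suc (B ^ length S)) → w ∈ S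
  ∣shifted⇒∈ B S w w<B S<B d with w ∈? S
  ... | yes w∈S = w∈S
  ... | no w∉S = ⊥-elim (ℕ.<⇒≱ (ℕ.n<1+n (B ^ length S)) (ℕ.≤-trans (ℕ.m≤n+m _ w)
    (ℕ.≤-trans (∣⇒≤ {{>-nonZero (differences-positive S w w∉S)}} divides-it)
      (differences-bounded B S w w<B S<B))))
    where
    divides-it : (w + suc (B ^ length S)) ∣ differences S w
    divides-it = subst ((w + suc (B ^ length S)) ∣_) (ℕ.*-identityʳ _) (divides-differences _ w S 1
      (subst ((w + suc (B ^ length S)) ∣_) (sym (ℕ.*-identityʳ _)) d))

  -- M, E, B are indices k of powers t^(k+1), whence the successors.
  Coded : (M E B : ℕ) → ℕ → Set
  Coded M E B v = v < suc B × (v + suc E) ∣ suc M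

  encode : ∀ B S → (∀ {v} → v ∈ S → v < suc B) →
    ∃ λ M → ∃ λ E → ∀ v → (Coded M E B v → v ∈ S) × (v ∈ S → Coded M E B v)
  -- The product and the shift are exponents, both positive; as indices they are one less.
  encode B S S<B = ℕ.pred (shifted S E) , suc B ^ length S , λ v →
    (λ (v<B , d) → ∣shifted⇒∈ (suc B) S v v<B S<B (subst (v + E ∣_) positive d)) ,
    (λ v∈S → S<B v∈S , subst (v + E ∣_) (sym positive) (∈⇒∣shifted E v∈S))
    where
    E = suc (suc B ^ length S)
    positive : suc (ℕ.pred (shifted S E)) ≡ shifted S E
    positive = ℕ.suc-pred _ {{>-nonZero (shifted-positive S _)}}

  coded-empty : ∃ λ M → ∃ λ E → ∀ v → ¬ Coded M E 0 v
  coded-empty with encode 0 [] (λ ())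
  ... | M , E , h = M , E , λ v cv → absurd (proj₁ (h v) cv)
    where
    absurd : ∀ {v} → ¬ v ∈ []
    absurd ()

  -- A larger set needs a larger shift, so the code is not updated: the old members, which are
  -- decidable and bounded for arbitrary `M`, `E`, `B`, are listed and encoded afresh with the new
  -- one.
  coded-adjoin : ∀ M E B v₀ → ∃ λ M′ → ∃ λ E′ → ∃ λ B′ → ∀ v →
    (Coded M′ E′ B′ v → Coded M E B v ⊎ v ≡ v₀) × (Coded M E B v ⊎ v ≡ v₀ → Coded M′ E′ B′ v)
  coded-adjoin M E B v₀ with encode (B + v₀) S bounded
    where
    P? = λ v → (v + suc E) ∣? suc M
    S = v₀ ∷ filter P? (upTo (suc B))
    bounded : ∀ {v} → v ∈ S → v < suc (B + v₀)
    bounded (here ≡.refl) = s≤s (ℕ.m≤n+m v₀ B)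
    bounded (there v∈)    =
      ℕ.≤-trans (∈-upTo⁻ (proj₁ (∈-filter⁻ P? v∈))) (s≤s (ℕ.m≤m+n B v₀))
  ... | M′ , E′ , h = M′ , E′ , B + v₀ , λ v →
    (λ cv → old-or-new (proj₁ (h v) cv)) ,
    (λ { (inj₁ (v<B , d)) → proj₂ (h v) (there (∈-filter⁺ P? (∈-upTo⁺ v<B) d))
       ; (inj₂ e) → proj₂ (h v) (here e) })
    where
    P? = λ v → (v + suc E) ∣? suc M
    old-or-new : ∀ {v} → v ∈ v₀ ∷ filter P? (upTo (suc B)) → Coded M E B v ⊎ v ≡ v₀
    old-or-new (here e)   = inj₂ e
    old-or-new (there v∈) with ∈-filter⁻ P? v∈
    ... | v∈B , d = inj₁ (∈-upTo⁻ v∈B , d)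

  open import Data.Nat.Coprimality using (Coprime; coprime-divisor)

  consecutive-coprime : ∀ s → Coprime s (suc s)
  consecutive-coprime s {d} (d∣s , d∣1+s) =
    ∣1⇒≡1 (∣m+n∣m⇒∣n (subst (d ∣_) (ℕ.+-comm 1 s) d∣1+s) d∣s)

  consecutive-product-∣ : ∀ s L → s ∣ L → suc s ∣ L → s * suc s ∣ L
  consecutive-product-∣ s L s∣L (divides q ≡.refl) =
    *-monoˡ-∣ (suc s) (coprime-divisor (consecutive-coprime s) (subst (s ∣_) (ℕ.*-comm q (suc s)) s∣L))

-- Factors of a monomial in one variable.

module Sequences {c ℓ : Level} (K : Field c ℓ) where
  open Field K hiding (zero)
  open DoubleNegation
  open import Relation.Binary.Reasoning.Setoid setoid

  Seq : Set c
  Seq = ℕ → Carrier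

  -- The k-th term stands for the coefficient of x^(k+1), whence the shift.
  seqConv : Seq → Seq → Seq
  seqConv f g zero    = 0#
  seqConv f g (suc k) = f 0 * g k + seqConv (λ i → f (suc i)) g k

  seqConv-0ˡ : ∀ f g k → (∀ j → f j ≈ 0#) → seqConv f g k ≈ 0#
  seqConv-0ˡ f g zero    f≈0 = refl
  seqConv-0ˡ f g (suc k) f≈0 = trans
    (+-cong (trans (*-congʳ (f≈0 0)) (zeroˡ _)) (seqConv-0ˡ _ g k (λ j → f≈0 (suc j))))
    (+-identityˡ 0#)

  seqConv-0ʳ : ∀ f g k → (∀ j → j < k → g j ≈ 0#) → seqConv f g k ≈ 0#
  seqConv-0ʳ f g zero    g≈0 = refl
  seqConv-0ʳ f g (suc k) g≈0 = trans
    (+-cong (trans (*-congˡ (g≈0 k (ℕ.n<1+n k))) (zeroʳ _))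
            (seqConv-0ʳ _ g k (λ j j<k → g≈0 j (ℕ.m<n⇒m<1+n j<k))))
    (+-identityˡ 0#)

  seqConv-lowest : ∀ f g p → (∀ j → j < p → g j ≈ 0#) → seqConv f g (suc p) ≈ f 0 * g p
  seqConv-lowest f g p g≈0 =
    trans (+-cong refl (seqConv-0ʳ _ g p g≈0)) (+-identityʳ _)

  seqConv-highest : ∀ f g J q → (∀ j → J < j → f j ≈ 0#) → (∀ j → q < j → g j ≈ 0#) →
                    seqConv f g (suc (J ℕ.+ q)) ≈ f J * g q
  seqConv-highest f g zero q f≈0 g≈0 =
    trans (+-cong refl (seqConv-0ˡ _ g q (λ j → f≈0 (suc j) (s≤s z≤n)))) (+-identityʳ _)
  seqConv-highest f g (suc J) q f≈0 g≈0 = trans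
    (+-cong (trans (*-congˡ (g≈0 (suc J ℕ.+ q) (s≤s (ℕ.m≤n+m q J)))) (zeroʳ _))
            (seqConv-highest _ g J q (λ j J<j → f≈0 (suc j) (s≤s J<j)) g≈0))
    (+-identityˡ _)

  *-≉0 : ∀ {a b} → ¬ (a ≈ 0#) → ¬ (b ≈ 0#) → ¬ (a * b ≈ 0#)
  *-≉0 {a} {b} a≉0 b≉0 ab≈0 = b≉0 (begin
    b              ≈⟨ sym (*-identityˡ b) ⟩
    1# * b         ≈⟨ *-congʳ (sym (proj₂ (inverse a a≉0))) ⟩
    a * a⁻¹ * b    ≈⟨ *-congʳ (*-comm a a⁻¹) ⟩
    a⁻¹ * a * b    ≈⟨ *-assoc a⁻¹ a b ⟩
    a⁻¹ * (a * b)  ≈⟨ *-congˡ ab≈0 ⟩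
    a⁻¹ * 0#       ≈⟨ zeroʳ a⁻¹ ⟩
    0#             ∎)
    where a⁻¹ = proj₁ (inverse a a≉0)

  -- A bounded search; each test whether a coefficient vanishes is a classical case distinction,
  -- hence the double negation.
  lowest : ∀ (g : Seq) N → ¬ ¬ ((∀ j → j < N → g j ≈ 0#) ⊎
           (∃ λ p → ¬ (g p ≈ 0#) × (∀ j → j < p → g j ≈ 0#)))
  lowest g zero    = return (inj₁ (λ _ ()))
  lowest g (suc N) = lowest g N >>= λ where
      (inj₂ h) → return (inj₂ h)
      (inj₁ below) → by-cases >>= λ where
        (inj₁ gN≈0) → return (inj₁ (below-suc below gN≈0))
        (inj₂ gN≉0) → return (inj₂ (N , gN≉0 , below))

  from-≤ : ∀ (g : Seq) N → g N ≈ 0# → (∀ j → N < j → g j ≈ 0#) → ∀ j → N ≤ j → g j ≈ 0#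
  from-≤ g N gN≈0 above j N≤j with ℕ.m≤n⇒m<n∨m≡n N≤j
  ... | inj₁ N<j    = above j N<j
  ... | inj₂ ≡.refl = gN≈0

  highest : ∀ (g : Seq) N → (∀ j → N ≤ j → g j ≈ 0#) → ¬ ¬ ((∀ j → g j ≈ 0#) ⊎
            (∃ λ q → ¬ (g q ≈ 0#) × (∀ j → q < j → g j ≈ 0#)))
  highest g zero    above = return (inj₁ (λ j → above j z≤n))
  highest g (suc N) above = by-cases >>= λ where
    (inj₁ gN≈0) → highest g N (from-≤ g N gN≈0 above)
    (inj₂ gN≉0) → return (inj₂ (N , gN≉0 , above))

  -- If f · g = x^(k+1) then the extreme terms of f and g multiply to extreme terms of the
  -- product, so that f has only one.
  monomial-factor : ∀ f g k N → (∀ j → N ≤ j → f j ≈ 0#) → (∀ j → N ≤ j → g j ≈ 0#) →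
    ¬ (seqConv f g k ≈ 0#) → (∀ j → ¬ (j ≡ k) → seqConv f g j ≈ 0#) → ¬ (f 0 ≈ 0#) →
    ¬ ¬ (∀ j → f (suc j) ≈ 0#)
  monomial-factor f g k N f-above g-above at-k off-k f0≉0 = lowest g k >>= λ where
      (inj₁ g≈0) → ⊥-elim (at-k (seqConv-0ʳ f g k g≈0))
      (inj₂ (p , gp≉0 , p-lowest)) → highest g N g-above >>= λ where
        (inj₁ g≈0) → ⊥-elim (gp≉0 (g≈0 p))
        (inj₂ (q , gq≉0 , q-highest)) → do
          let k≡1+p : k ≡ suc p
              k≡1+p = hits (λ e → *-≉0 f0≉0 gp≉0 (trans (sym (seqConv-lowest f g p p-lowest)) e))
              p≤q : p ≤ q
              p≤q = ℕ.≮⇒≥ (λ q<p → gp≉0 (q-highest p q<p))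
              -- A leading term of `f` at J + 1 would give k = J + q + 2, whereas k = p + 1 ≤ q + 1.
              -- So each candidate for a leading term vanishes in turn.
              top : ∀ J → (∀ j → suc J < j → f j ≈ 0#) → ¬ ¬ (f (suc J) ≈ 0#)
              top J above fJ≉0 = ℕ.<⇒≢ (s≤s (s≤s (ℕ.≤-trans p≤q (ℕ.m≤n+m q J))))
                (≡.trans (≡.sym k≡1+p) (hits (λ e → *-≉0 fJ≉0 gq≉0
                  (trans (sym (seqConv-highest f g (suc J) q above q-highest)) e))))
          vanish ← down top N (λ j N<j → f-above j (ℕ.<⇒≤ N<j))
          return (λ j → vanish (suc j) (s≤s z≤n))
    where
    hits : ∀ {j} → ¬ (seqConv f g j ≈ 0#) → k ≡ j
    hits {j} h with j ℕ.≟ k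
    ... | yes e = ≡.sym e
    ... | no ne = ⊥-elim (h (off-k j ne))
    down : (∀ J → (∀ j → suc J < j → f j ≈ 0#) → ¬ ¬ (f (suc J) ≈ 0#)) →
           ∀ N → (∀ j → N < j → f j ≈ 0#) → ¬ ¬ (∀ j → 0 < j → f j ≈ 0#)
    down top zero    above = return above
    down top (suc N) above = do
      z ← top N above
      down top N (from-≤ f (suc N) z above)

-- Elements commuting with a generator, and divisors of its powers.

module Generator {c ℓ : Level} (K : Field c ℓ) (m : ℕ) where
  open Field K hiding (zero)
  open FreeAlgebra K (suc m)
  open FreeAlgebraLaws K (suc m)
  open DoubleNegation
  open Sequences K
  open import Relation.Binary.Reasoning.Setoid setoid

  Word : Set
  Word = List (Fin (suc m))

  x : Elem
  x = (1# , (fzero , [])) ∷ []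

  -- Coefficients are extended by 0 to the empty word, so that stripping a letter from either end
  -- needs no side condition.
  cfw : Elem → Word → Carrier
  cfw p []       = 0#
  cfw p (y ∷ ws) = cf p y ws

  cf-x : cf x fzero [] ≈ 1#
  cf-x = trans (coeff-∷ 1# (fzero , []) [] (fzero , []))
    (trans (+-cong (δ-same 1# (fzero , [])) refl) (+-identityʳ 1#))

  cf-x-long : ∀ y z zs → cf x y (z ∷ zs) ≈ 0#
  cf-x-long y z zs = trans (coeff-∷ 1# (fzero , []) [] (y , z ∷ zs))
    (trans (+-cong (δ-other 1# (y , z ∷ zs) (fzero , []) λ ()) refl) (+-identityʳ 0#))

  cf-x-snoc : ∀ z zs → cf x z (zs ++ fzero ∷ []) ≈ 0#
  cf-x-snoc z []       = cf-x-long z fzero []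
  cf-x-snoc z (y ∷ ys) = cf-x-long z y (ys ++ fzero ∷ [])

  x·-scaled : ∀ p n → coeff (x *ᴬ p) n ≈ coeff (scaled 1# (fzero , []) p) n
  x·-scaled p n = trans (coeff-+ (scaled 1# (fzero , []) p) [] n) (+-identityʳ _)

  cfw-x· : ∀ p w → cfw (x *ᴬ p) (fzero ∷ w) ≈ cfw p w
  cfw-x· p []       = trans (x·-scaled p (fzero , []))
    (coeff-scaled-0 1# (fzero , []) p (fzero , []) (λ _ ()))
  cfw-x· p (z ∷ zs) = trans (x·-scaled p (fzero , z ∷ zs))
    (trans (coeff-scaled 1# (fzero , []) p (z , zs)) (*-identityˡ _))

  cf-x·-other : ∀ p i ws → cf (x *ᴬ p) (fsuc i) ws ≈ 0#
  cf-x·-other p i ws = trans (x·-scaled p (fsuc i , ws))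
    (coeff-scaled-0 1# (fzero , []) p (fsuc i , ws) (λ _ ()))

  cfw-·x : ∀ p w → cfw (p *ᴬ x) (w ++ fzero ∷ []) ≈ cfw p w
  cfw-·x p []       = coeff-* p x fzero []
  cfw-·x p (y ∷ ws) = trans (coeff-* p x y (ws ++ fzero ∷ [])) (last-letter (cf p) y ws)
    where
    last-letter : ∀ f y ws → conv f (cf x) y (ws ++ fzero ∷ []) ≈ f y ws
    last-letter f y []       = trans (+-identityʳ _) (trans (*-congˡ cf-x) (*-identityʳ _))
    last-letter f y (z ∷ zs) = trans
      (+-cong (trans (*-congˡ (cf-x-snoc z zs)) (zeroʳ _)) (last-letter (shift y f) z zs))
      (+-identityˡ _)

  x·-cancel : ∀ {p q} → x *ᴬ p ≋ x *ᴬ q → p ≋ q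
  x·-cancel {p} {q} e = mk≋ λ (y , ys) → trans (sym (cfw-x· p (y ∷ ys)))
    (trans (at e (fzero , y ∷ ys)) (cfw-x· q (y ∷ ys)))

  zeros : ℕ → Word
  zeros k = replicate k fzero

  Commutes : Elem → Set ℓ
  Commutes p = p *ᴬ x ≋ x *ᴬ p

  commutes⇒head : ∀ p → Commutes p → ∀ i ws → cf p (fsuc i) ws ≈ 0#
  commutes⇒head p com i ws = trans (sym (cfw-·x p (fsuc i ∷ ws)))
    (trans (at com (fsuc i , ws ++ fzero ∷ [])) (cf-x·-other p i _))

  rotate : ∀ p → Commutes p → ∀ w → cfw p (fzero ∷ w) ≈ cfw p (w ++ fzero ∷ [])
  rotate p com w = trans (sym (cfw-·x p (fzero ∷ w)))
    (trans (at com (fzero , w ++ fzero ∷ [])) (cfw-x· p (w ++ fzero ∷ [])))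

  -- By `rotate` the leading letters x can be moved to the end one by one, until the word begins
  -- with another letter, where `commutes⇒head` applies.
  commutes⇒pure : ∀ p → Commutes p → ∀ k i w → cfw p (zeros k ++ fsuc i ∷ w) ≈ 0#
  commutes⇒pure p com zero    i w = commutes⇒head p com i w
  commutes⇒pure p com (suc k) i w = begin
    cfw p (fzero ∷ zeros k ++ fsuc i ∷ w)           ≈⟨ rotate p com (zeros k ++ fsuc i ∷ w) ⟩
    cfw p ((zeros k ++ fsuc i ∷ w) ++ fzero ∷ [])
      ≡⟨ ≡.cong (cfw p) (ListP.++-assoc (zeros k) (fsuc i ∷ w) (fzero ∷ [])) ⟩
    cfw p (zeros k ++ fsuc i ∷ (w ++ fzero ∷ []))   ≈⟨ commutes⇒pure p com k i (w ++ fzero ∷ []) ⟩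
    0#                                              ∎

  data Shape : Word → Set where
    pure  : ∀ k → Shape (zeros k)
    mixed : ∀ k i w → Shape (zeros k ++ fsuc i ∷ w)

  shape : ∀ w → Shape w
  shape []           = pure 0
  shape (fsuc i ∷ w) = mixed 0 i w
  shape (fzero ∷ w) with shape w
  ... | pure k      = pure (suc k)
  ... | mixed k i v = mixed (suc k) i v

  -- This is the homomorphism that sends all other generators to 0. Its multiplicativity therefore
  -- holds for every element, including the cofactors in the formulas, which are not assumed to
  -- commute with x.
  hat : Elem → Seq
  hat p k = cf p fzero (zeros k)

  hat-cong : ∀ {p q} → p ≋ q → ∀ k → hat p k ≈ hat q k
  hat-cong e k = at e (fzero , zeros k)

  commutes-ext : ∀ p q → Commutes p → Commutes q → (∀ k → hat p k ≈ hat q k) → p ≋ q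
  commutes-ext p q com-p com-q same = mk≋ λ (y , ys) → by-shape (shape (y ∷ ys))
    where
    by-shape : ∀ {w} → Shape w → cfw p w ≈ cfw q w
    by-shape (pure zero)    = refl
    by-shape (pure (suc k)) = same k
    by-shape (mixed k i w)  = trans (commutes⇒pure p com-p k i w) (sym (commutes⇒pure q com-q k i w))

  hat-x·-zero : ∀ p → hat (x *ᴬ p) 0 ≈ 0#
  hat-x·-zero p = cfw-x· p []

  hat-x·-suc : ∀ p k → hat (x *ᴬ p) (suc k) ≈ hat p k
  hat-x·-suc p k = cfw-x· p (zeros (suc k))

  hat-·-zero : ∀ p q → hat (p *ᴬ q) 0 ≈ 0#
  hat-·-zero p q = coeff-* p q fzero []

  zeros-snoc : ∀ k → zeros k ++ fzero ∷ [] ≡ zeros (suc k)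
  zeros-snoc zero    = ≡.refl
  zeros-snoc (suc k) = ≡.cong (fzero ∷_) (zeros-snoc k)

  hat-·x-suc : ∀ p k → hat (p *ᴬ x) (suc k) ≈ hat p k
  hat-·x-suc p k = begin
    cf (p *ᴬ x) fzero (zeros (suc k))           ≡⟨ ≡.cong (cf (p *ᴬ x) fzero) (≡.sym (zeros-snoc k)) ⟩
    cf (p *ᴬ x) fzero (zeros k ++ fzero ∷ [])   ≈⟨ cfw-·x p (fzero ∷ zeros k) ⟩
    cf p fzero (zeros k)                        ∎

  hat-· : ∀ p q k → hat (p *ᴬ q) k ≈ seqConv (hat p) (hat q) k
  hat-· p q k = trans (coeff-* p q fzero (zeros k)) (restrict (cf p) k)
    where
    restrict : ∀ f k → conv f (cf q) fzero (zeros k) ≈ seqConv (λ i → f fzero (zeros i)) (hat q) k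
    restrict f zero    = refl
    restrict f (suc k) = +-cong refl (restrict (shift fzero f) k)

  hat-+ : ∀ p q k → hat (p +ᴬ q) k ≈ hat p k + hat q k
  hat-+ p q k = coeff-+ p q (fzero , zeros k)

  hat-bound : ∀ p → ∃ λ N → ∀ j → N ≤ j → hat p j ≈ 0#
  hat-bound p = bound (degree-bound p)
    where
    bound : (∃ λ N → ∀ y ws → N ≤ length ws → cf p y ws ≈ 0#) → ∃ λ N → ∀ j → N ≤ j → hat p j ≈ 0#
    bound (N , high) = N , λ j N≤j →
      high fzero (zeros j) (≡.subst (N ≤_) (≡.sym (ListP.length-replicate j)) N≤j)

  hat-pow-same : ∀ k → hat (x ^1+ k) k ≈ 1#
  hat-pow-same zero    = cf-x
  hat-pow-same (suc k) = trans (hat-x·-suc (x ^1+ k) k) (hat-pow-same k)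

  hat-pow-other : ∀ k j → ¬ (j ≡ k) → hat (x ^1+ k) j ≈ 0#
  hat-pow-other zero    zero    ne = ⊥-elim (ne ≡.refl)
  hat-pow-other zero    (suc j) ne = cf-x-long fzero fzero (zeros j)
  hat-pow-other (suc k) zero    ne = hat-x·-zero (x ^1+ k)
  hat-pow-other (suc k) (suc j) ne =
    trans (hat-x·-suc (x ^1+ k) j) (hat-pow-other k j (λ e → ne (≡.cong suc e)))

  pow-≉0 : ∀ k → ¬ (x ^1+ k ≋ 0ᴬ)
  pow-≉0 k e = Field.1≉0 K (trans (sym (hat-pow-same k)) (hat-cong e k))

  commutes-pow : ∀ k → Commutes (x ^1+ k)
  commutes-pow k = ≋-sym (pow-suc x k)

  commutes-cong : ∀ {p q} → p ≋ q → Commutes p → Commutes q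
  commutes-cong e com = ≋-trans (·-congʳ x (≋-sym e)) (≋-trans com (·-congˡ x e))

  Monic : Elem → Elem → Set ℓ
  Monic v z = (v +ᴬ z) ≋ ((z *ᴬ x) +ᴬ x)

  monic-pow : ∀ k → ∃ λ z → Monic (x ^1+ k) z
  monic-pow zero    = 0ᴬ , +-identityʳ≋ x
  monic-pow (suc k) with monic-pow k
  -- The geometric sum: for x^(k+1) the quotient is x + ... + x^k, and it grows by z ↦ x z + x.
  ... | z , e = (x *ᴬ z) +ᴬ x , ≋-trans (≋-sym (+-assoc≋ (x *ᴬ x ^1+ k) (x *ᴬ z) x))
    (+-cong≋ (≋-trans (≋-sym (·-distribˡ x (x ^1+ k) z)) (≋-trans (·-congˡ x e)
      (≋-trans (·-distribˡ x (z *ᴬ x) x) (≋-trans (+-cong≋ (≋-sym (·-assoc x z x)) ≋-refl)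
        (≋-sym (·-distribʳ (x *ᴬ z) x x)))))) ≋-refl)

  -- Above the lowest degree the equation says that consecutive coefficients of `z` agree; as `z`
  -- has finitely many terms they all vanish, and the lowest degree reads off 1. This replaces
  -- evaluation at x = 1.
  monic-linear : ∀ v z → Monic v z → (∀ j → hat v (suc j) ≈ 0#) → hat v 0 ≈ 1#
  monic-linear v z e v≈0 = begin
    hat v 0                        ≈⟨ sym (+-identityʳ _) ⟩
    hat v 0 + 0#                   ≈⟨ +-cong refl (sym z0≈0) ⟩
    hat v 0 + hat z 0              ≈⟨ sym (hat-+ v z 0) ⟩
    hat (v +ᴬ z) 0                 ≈⟨ hat-cong e 0 ⟩
    hat ((z *ᴬ x) +ᴬ x) 0          ≈⟨ hat-+ (z *ᴬ x) x 0 ⟩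
    hat (z *ᴬ x) 0 + hat x 0       ≈⟨ +-cong (hat-·-zero z x) cf-x ⟩
    0# + 1#                        ≈⟨ +-identityˡ 1# ⟩
    1#                             ∎
    where
    constant : ∀ j → hat z (suc j) ≈ hat z j
    constant j = begin
      hat z (suc j)                           ≈⟨ sym (+-identityˡ _) ⟩
      0# + hat z (suc j)                      ≈⟨ +-cong (sym (v≈0 j)) refl ⟩
      hat v (suc j) + hat z (suc j)           ≈⟨ sym (hat-+ v z (suc j)) ⟩
      hat (v +ᴬ z) (suc j)                    ≈⟨ hat-cong e (suc j) ⟩
      hat ((z *ᴬ x) +ᴬ x) (suc j)             ≈⟨ hat-+ (z *ᴬ x) x (suc j) ⟩
      hat (z *ᴬ x) (suc j) + hat x (suc j)
        ≈⟨ +-cong (hat-·x-suc z j) (cf-x-long fzero fzero (zeros j)) ⟩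
      hat z j + 0#                            ≈⟨ +-identityʳ _ ⟩
      hat z j                                 ∎
    all-equal : ∀ j → hat z j ≈ hat z 0
    all-equal zero    = refl
    all-equal (suc j) = trans (constant j) (all-equal j)
    z0≈0 : hat z 0 ≈ 0#
    z0≈0 = trans (sym (all-equal (proj₁ (hat-bound z)))) (proj₂ (hat-bound z) _ ℕ.≤-refl)

  -- Left division by x. The terms that admit no such quotient are discarded; in `factor-x` their
  -- coefficients are 0.
  drop : Elem → Elem
  drop []                              = []
  drop ((a , (y , [])) ∷ p)            = drop p
  drop ((a , (fzero , w ∷ ws)) ∷ p)    = (a , (w , ws)) ∷ drop p
  drop ((a , (fsuc _ , w ∷ ws)) ∷ p)   = drop p

  cf-drop : ∀ p z zs → cf (drop p) z zs ≈ cf p fzero (z ∷ zs)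
  cf-drop [] z zs = refl
  cf-drop ((a , (y , [])) ∷ p) z zs = trans (cf-drop p z zs) (sym (trans
    (coeff-∷ a (y , []) p (fzero , z ∷ zs))
    (trans (+-cong (δ-other a (fzero , z ∷ zs) (y , []) λ ()) refl) (+-identityˡ _))))
  cf-drop ((a , (fzero , w ∷ ws)) ∷ p) z zs = trans (coeff-∷ a (w , ws) (drop p) (z , zs))
    (trans (+-cong (sym (shift-δ a fzero w ws z zs)) (cf-drop p z zs))
      (sym (coeff-∷ a (fzero , w ∷ ws) p (fzero , z ∷ zs))))
  cf-drop ((a , (fsuc i , w ∷ ws)) ∷ p) z zs = trans (cf-drop p z zs) (sym (trans
    (coeff-∷ a (fsuc i , w ∷ ws) p (fzero , z ∷ zs))
    (trans (+-cong (δ-other a (fzero , z ∷ zs) (fsuc i , w ∷ ws) λ ()) refl) (+-identityˡ _))))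

  factor-x : ∀ v → Commutes v → hat v 0 ≈ 0# → v ≋ x *ᴬ drop v
  factor-x v com v0≈0 = mk≋ λ
    { (fsuc i , ws)      → trans (commutes⇒head v com i ws) (sym (cf-x·-other (drop v) i ws))
    ; (fzero  , [])      → trans v0≈0 (sym (cfw-x· (drop v) []))
    ; (fzero  , z ∷ zs)  → trans (sym (cf-drop v z zs)) (sym (cfw-x· (drop v) (z ∷ zs)))
    }

  -- If the linear coefficient of `v` vanishes, x can be split off. Otherwise `monomial-factor`
  -- leaves only the linear term, and monicity makes its coefficient 1.
  divisor-of-pow : ∀ k v w z → Commutes v → Monic v z → x ^1+ k ≋ v *ᴬ w →
                   ¬ ¬ ((v ≋ x) ⊎ (∃ λ q → v ≋ x *ᴬ q))
  divisor-of-pow k v w z com monic e = by-cases >>= λ where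
      (inj₁ v0≈0) → return (inj₂ (drop v , factor-x v com v0≈0))
      (inj₂ v0≉0) → do
        v≈0 ← monomial-factor (hat v) (hat w) k N
          (λ j N≤j → proj₂ (hat-bound v) j (ℕ.≤-trans (ℕ.m≤m⊔n _ _) N≤j))
          (λ j N≤j → proj₂ (hat-bound w) j (ℕ.≤-trans (ℕ.m≤n⊔m _ _) N≤j))
          (λ at-k → Field.1≉0 K (trans (sym (hat-pow-same k)) (trans (product k) at-k)))
          (λ j ne → trans (sym (product j)) (hat-pow-other k j ne))
          v0≉0
        return (inj₁ (commutes-ext v x com (commutes-pow 0) λ where
          zero    → trans (monic-linear v z monic v≈0) (sym cf-x)
          (suc j) → trans (v≈0 j) (sym (cf-x-long fzero fzero (zeros j)))))
    where
    N = proj₁ (hat-bound v) ℕ.⊔ proj₁ (hat-bound w)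
    product : ∀ j → hat (x ^1+ k) j ≈ seqConv (hat v) (hat w) j
    product j = trans (hat-cong e j) (hat-· v w j)

  scale : Carrier → Elem → Elem
  scale a = map (λ bm → (a * proj₁ bm) , proj₂ bm)

  coeff-scale : ∀ a p n → coeff (scale a p) n ≈ a * coeff p n
  coeff-scale a []             n = sym (zeroʳ a)
  coeff-scale a ((b , k) ∷ p) n = begin
    coeff (scale a ((b , k) ∷ p)) n       ≈⟨ coeff-∷ (a * b) k (scale a p) n ⟩
    δ (a * b) k n + coeff (scale a p) n   ≈⟨ +-cong δ-scale (coeff-scale a p n) ⟩
    a * δ b k n + a * coeff p n           ≈⟨ sym (distribˡ a _ _) ⟩
    a * (δ b k n + coeff p n)             ≈⟨ *-congˡ (sym (coeff-∷ b k p n)) ⟩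
    a * coeff ((b , k) ∷ p) n             ∎
    where
    δ-scale : δ (a * b) k n ≈ a * δ b k n
    δ-scale with n ≟ₘ k
    ... | yes _ = refl
    ... | no  _ = sym (zeroʳ a)

  scale-· : ∀ a p q n → coeff (scale a p *ᴬ q) n ≈ a * coeff (p *ᴬ q) n
  scale-· a p q (y , ys) = begin
    cf (scale a p *ᴬ q) y ys                  ≈⟨ coeff-* (scale a p) q y ys ⟩
    conv (cf (scale a p)) (cf q) y ys
      ≈⟨ conv-cong {f = cf (scale a p)} {g = cf q} (λ z zs → coeff-scale a p (z , zs)) (λ _ _ → refl) y ys ⟩
    conv (λ z zs → a * cf p z zs) (cf q) y ys ≈⟨ conv-*ˡ a (cf p) (cf q) y ys ⟩
    a * conv (cf p) (cf q) y ys               ≈⟨ *-congˡ (sym (coeff-* p q y ys)) ⟩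
    a * cf (p *ᴬ q) y ys                      ∎

  -- v - x = (x v - x) - v (x - 1).
  monic-quotient : ∀ v z → Commutes v → Monic (x *ᴬ v) z → Monic v (z +ᴬ scale (- 1#) v)
  monic-quotient v z com e = mk≋ λ n → begin
    coeff (v +ᴬ (z +ᴬ scale (- 1#) v)) n
      ≈⟨ trans (coeff-+ v _ n) (+-cong refl (trans (coeff-+ z _ n) (+-cong refl (neg n)))) ⟩
    coeff v n + (coeff z n + - coeff v n)
      ≈⟨ trans (+-comm _ _) (trans (+-assoc _ _ _) (trans (+-cong refl (-‿inverseˡ _)) (+-identityʳ _))) ⟩
    coeff z n
      ≈⟨ sym (trans (+-assoc _ _ _) (trans (+-cong refl (-‿inverseˡ _)) (+-identityʳ _))) ⟩
    (coeff z n + - coeff (v *ᴬ x) n) + coeff (v *ᴬ x) n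
      ≈⟨ trans (+-assoc _ _ _) (trans (+-cong refl (+-comm _ _)) (sym (+-assoc _ _ _))) ⟩
    (coeff z n + coeff (v *ᴬ x) n) + - coeff (v *ᴬ x) n
      ≈⟨ +-cong (trans (+-comm _ _) (trans (+-cong (at com n) refl)
           (trans (sym (coeff-+ (x *ᴬ v) z n)) (trans (at e n) (coeff-+ (z *ᴬ x) x n))))) refl ⟩
    (coeff (z *ᴬ x) n + coeff x n) + - coeff (v *ᴬ x) n
      ≈⟨ trans (+-assoc _ _ _) (trans (+-cong refl (+-comm _ _)) (sym (+-assoc _ _ _))) ⟩
    (coeff (z *ᴬ x) n + - coeff (v *ᴬ x) n) + coeff x n
      ≈⟨ +-cong (+-cong refl (sym (neg· n))) refl ⟩
    (coeff (z *ᴬ x) n + coeff (scale (- 1#) v *ᴬ x) n) + coeff x n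
      ≈⟨ +-cong (sym (coeff-+ (z *ᴬ x) (scale (- 1#) v *ᴬ x) n)) refl ⟩
    coeff ((z *ᴬ x) +ᴬ (scale (- 1#) v *ᴬ x)) n + coeff x n
      ≈⟨ +-cong (at (≋-sym (·-distribʳ z (scale (- 1#) v) x)) n) refl ⟩
    coeff ((z +ᴬ scale (- 1#) v) *ᴬ x) n + coeff x n
      ≈⟨ sym (coeff-+ ((z +ᴬ scale (- 1#) v) *ᴬ x) x n) ⟩
    coeff (((z +ᴬ scale (- 1#) v) *ᴬ x) +ᴬ x) n ∎
    where
    open import Algebra.Properties.Ring ring using (-1*x≈-x)
    neg : ∀ n → coeff (scale (- 1#) v) n ≈ - coeff v n
    neg n = trans (coeff-scale (- 1#) v n) (-1*x≈-x _)
    neg· : ∀ n → coeff (scale (- 1#) v *ᴬ x) n ≈ - coeff (v *ᴬ x) n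
    neg· n = trans (scale-· (- 1#) v x n) (-1*x≈-x _)

-- The formulas interpreted at a generator x.

module StandardModel {c ℓ : Level} (K : Field c ℓ) (m : ℕ) where
  open FreeAlgebra K (suc m)
  open FreeAlgebraLaws K (suc m)
  open Semantics K (suc m)
  open DoubleNegation
  open Numerals K (suc m)
  open Generator K m
  open FiniteSetCoding
  open Field K using (_≈_)
  open import Data.Nat using (_+_; _*_)
  open import Data.Nat.Divisibility

  _≐ˢ_ : Elem → Elem → Set (c ⊔ ℓ)
  p ≐ˢ q = ¬ ¬ Lift c (p ≈ᴬ q)

  MonicS : Elem → Set (c ⊔ ℓ)
  MonicS v = ¬ (∀ z → ¬ ((v +ᴬ z) ≐ˢ ((z *ᴬ x) +ᴬ x)))

  LeftFactorS : Elem → Elem → Set (c ⊔ ℓ)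
  LeftFactorS v u = ¬ (¬ (u ≐ˢ v) × ¬ ¬ (∀ w → ¬ (u ≐ˢ (v *ᴬ w))))

  left-factor-elim : ∀ {v u} → LeftFactorS v u → ¬ ¬ ((u ≋ v) ⊎ (∃ λ w → u ≋ v *ᴬ w))
  left-factor-elim {v} {u} h = ∨-elim h >>= λ where
    (inj₁ e) → do
      e ← ≐-elim e
      return (inj₁ e)
    (inj₂ h) → do
      w , e ← ∃-elim h
      e ← ≐-elim e
      return (inj₂ (w , e))

  left-factor-intro : ∀ {v u} → (u ≋ v) ⊎ (∃ λ w → u ≋ v *ᴬ w) → LeftFactorS v u
  left-factor-intro (inj₁ e)       = λ (k , _) → k (≐-intro e)
  left-factor-intro (inj₂ (w , e)) = λ (_ , k) → k (∃-intro w (≐-intro e))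

  Num-intro : ∀ {u} → Commutes u → MonicS u → ¬ (u ≋ 0ᴬ) →
    (∀ v → Commutes v → MonicS v → (u ≋ v) ⊎ (∃ λ w → u ≋ v *ᴬ w) → LeftFactorS x v) →
    Num x u
  Num-intro com monic nonzero divisors = ≐-intro com , monic ,
    (λ u≐0 → lift (u≐0 (λ e → nonzero (mk≋ (lower e))))) ,
    λ v com-v monic-v v∣u nope → (do
      com-v ← ≐-elim com-v
      v∣u ← left-factor-elim v∣u
      return (divisors v com-v monic-v v∣u)) (λ h → h nope)

  Num-x-stable : ∀ {u} → ¬ ¬ Num x u → Num x u
  Num-x-stable {u} = Sat-stable (NumF (# 0) (# 1)) (lookup (x ∷ u ∷ []))

  pow⇒num-x : ∀ k {u} → u ≋ x ^1+ k → Num x u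
  pow⇒num-x k {u} e = Num-intro (commutes-cong (≋-sym e) (commutes-pow k))
    (∃-intro (proj₁ (monic-pow k)) (≐-intro (≋-trans (+-cong≋ e ≋-refl) (proj₂ (monic-pow k)))))
    (λ u≋0 → pow-≉0 k (≋-trans (≋-sym e) u≋0))
    λ v com monic v∣u → λ nope → (do
      z , monic ← ∃-elim monic
      monic ← ≐-elim monic
      h ← cases v∣u com monic k e
      return (left-factor-intro h)) (λ h → h nope)
    where
    cases : ∀ {u v z} → (u ≋ v) ⊎ (∃ λ w → u ≋ v *ᴬ w) → Commutes v → Monic v z →
            ∀ k → u ≋ x ^1+ k → ¬ ¬ ((v ≋ x) ⊎ (∃ λ q → v ≋ x *ᴬ q))
    cases (inj₁ u≋v) com monic zero    e = return (inj₁ (≋-trans (≋-sym u≋v) e))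
    cases (inj₁ u≋v) com monic (suc k) e = return (inj₂ (x ^1+ k , ≋-trans (≋-sym u≋v) e))
    cases {v = v} {z} (inj₂ (w , u≋vw)) com monic k e =
      divisor-of-pow k v w z com monic (≋-trans (≋-sym e) u≋vw)

  -- Applying the divisor clause to `u` itself gives u = x or u = x v. The quotient inherits the
  -- divisor clause, because a divisor of v commuting with x also divides x v.
  num-predecessor : ∀ {u} → Num x u → ¬ ¬ ((u ≋ x) ⊎ (∃ λ v → Num x v × u ≋ x *ᴬ v))
  num-predecessor {u} num@(com , monic , nonzero , divisors) = do
    h ← left-factor-elim {x} {u} (divisors u com monic (left-factor-intro {u} (inj₁ ≋-refl)))
    com ← ≐-elim com
    z , monic ← ∃-elim monic
    monic ← ≐-elim monic
    return (quotient-num h com z monic)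
    where
    quotient-num : (u ≋ x) ⊎ (∃ λ q → u ≋ x *ᴬ q) → Commutes u → ∀ z → Monic u z →
                   (u ≋ x) ⊎ (∃ λ v → Num x v × u ≋ x *ᴬ v)
    quotient-num (inj₁ u≋x)        com z monic = inj₁ u≋x
    quotient-num (inj₂ (v , u≋xv)) com z monic = inj₂ (v , Num-intro com-v
      (∃-intro _ (≐-intro (monic-quotient v z com-v (≋-trans (+-cong≋ (≋-sym u≋xv) ≋-refl) monic))))
      (λ v≋0 → lower (nonzero (≐-intro (≋-trans u≋xv (·-congˡ x v≋0)))))
      (λ w com-w monic-w w∣v → divisors w (≐-intro com-w) monic-w
        (left-factor-intro {w} (inj₂ (lift-factor com-w w∣v)))) , u≋xv)
      where
      com-v : Commutes v
      com-v = x·-cancel (≋-trans (≋-sym (·-assoc x v x)) (≋-trans (·-congʳ x (≋-sym u≋xv))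
        (≋-trans com (·-congˡ x u≋xv))))
      lift-factor : ∀ {w} → Commutes w → (v ≋ w) ⊎ (∃ λ q → v ≋ w *ᴬ q) → ∃ λ q → u ≋ w *ᴬ q
      lift-factor com-w (inj₁ v≋w) = x , ≋-trans u≋xv (≋-trans (·-congˡ x v≋w) (≋-sym com-w))
      lift-factor {w} com-w (inj₂ (q , v≋wq)) = x *ᴬ q , ≋-trans u≋xv (≋-trans (·-congˡ x v≋wq)
        (≋-trans (≋-sym (·-assoc x w q)) (≋-trans (·-congʳ q (≋-sym com-w)) (·-assoc w x q))))

  num⇒pow-x : ∀ {u} → Num x u → ¬ ¬ ∃ λ k → u ≋ x ^1+ k
  num⇒pow-x = descent (Num x) x
    (λ num e → lower (proj₁ (proj₂ (proj₂ num)) (≐-intro e))) num-predecessor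

  x-pow-injective : ∀ {i j u} → u ≋ x ^1+ i → u ≋ x ^1+ j → i ≡ j
  x-pow-injective {i} {j} e e′ = ^1+-injective x pow-≉0 i j (≋-trans (≋-sym e) e′)

  DividesS : Elem → Elem → Set (c ⊔ ℓ)
  DividesS u w = ¬ (∀ z → ¬ (((x *ᴬ w) +ᴬ z) ≐ˢ ((z *ᴬ u) +ᴬ x)))

  LessS : Elem → Elem → Set (c ⊔ ℓ)
  LessS u w = ¬ (∀ d → ¬ (Num x d × (w ≐ˢ (u *ᴬ d))))

  hat-·pow : ∀ a p j → hat (p *ᴬ x ^1+ a) (j + suc a) ≈ hat p j
  hat-·pow zero    p j = ≡.subst (λ i → hat (p *ᴬ x) i ≈ hat p j) (ℕ.+-comm 1 j) (hat-·x-suc p j)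
  hat-·pow (suc a) p j = Field.trans K (hat-cong (≋-sym (·-assoc p x (x ^1+ a))) (j + suc (suc a)))
    (Field.trans K (≡.subst (λ i → hat ((p *ᴬ x) *ᴬ x ^1+ a) i ≈ hat (p *ᴬ x) (suc j))
      (≡.sym (ℕ.+-suc j (suc a))) (hat-·pow a (p *ᴬ x) (suc j))) (hat-·x-suc p j))

  divides⇒∣ : ∀ {a b u w} → u ≋ x ^1+ a → w ≋ x ^1+ b → DividesS u w → suc a ∣ suc b
  divides⇒∣ {a} {b} u≋ w≋ h = decidable-stable (suc a ∣? suc b) (do
    z , e ← ∃-elim h
    e ← ≐-elim e
    λ a∤b → never-vanishes z (≋-trans (+-cong≋ (≋-sym (·-congˡ x w≋)) ≋-refl)
      (≋-trans e (+-cong≋ (·-congˡ z u≋) ≋-refl))) a∤b)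
    where
    open Field K using (0#; 1#; +-cong; refl; sym; trans; +-identityˡ; +-identityʳ; setoid)
      renaming (_+_ to _+ᴷ_)
    open import Relation.Binary.Reasoning.Setoid setoid
    -- Comparing coefficients: z has coefficient 1 at x and z_(j+a+1) = z_j unless j+a+1 = b+1,
    -- so without divisibility z would have infinitely many terms.
    never-vanishes : ∀ z → ((x ^1+ suc b) +ᴬ z) ≋ ((z *ᴬ x ^1+ a) +ᴬ x) → ¬ ¬ (suc a ∣ suc b)
    never-vanishes z e a∤b = Field.1≉0 K (trans (sym (ones N))
      (proj₂ (hat-bound z) (N * suc a) (ℕ.m≤m*n N (suc a))))
      where
      N = proj₁ (hat-bound z)
      recurrence : ∀ j → ¬ (j ≡ suc b) → hat z j ≈ (hat (z *ᴬ x ^1+ a) j +ᴷ hat x j)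
      recurrence j ne = begin
        hat z j                                 ≈⟨ sym (+-identityˡ _) ⟩
        0# +ᴷ hat z j                           ≈⟨ +-cong (sym (hat-pow-other (suc b) j ne)) refl ⟩
        hat (x ^1+ suc b) j +ᴷ hat z j          ≈⟨ sym (hat-+ (x ^1+ suc b) z j) ⟩
        hat ((x ^1+ suc b) +ᴬ z) j              ≈⟨ hat-cong e j ⟩
        hat ((z *ᴬ x ^1+ a) +ᴬ x) j             ≈⟨ hat-+ (z *ᴬ x ^1+ a) x j ⟩
        hat (z *ᴬ x ^1+ a) j +ᴷ hat x j         ∎
      ones : ∀ q → hat z (q * suc a) ≈ 1#
      ones zero = trans (recurrence 0 λ ())
        (trans (+-cong (hat-·-zero z (x ^1+ a)) cf-x) (+-identityˡ 1#))
      ones (suc q) = trans (recurrence (suc q * suc a) (λ eq → a∤b (divides (suc q) (≡.sym eq))))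
        (trans (+-cong (≡.subst (λ i → hat (z *ᴬ x ^1+ a) i ≈ hat z (q * suc a))
                          (ℕ.+-comm (q * suc a) (suc a)) (hat-·pow a z (q * suc a)))
                       (hat-pow-other 0 (suc q * suc a) λ ()))
        (trans (+-identityʳ _) (ones q)))

  ∣⇒divides : ∀ {a b u w} → u ≋ x ^1+ a → w ≋ x ^1+ b → suc a ∣ suc b → DividesS u w
  ∣⇒divides {a} {b} {u} {w} u≋ w≋ (divides (suc q) eq) =
    ∃-intro z (≐-intro (≋-trans (+-cong≋ (·-congˡ x w≋) (≋-refl {z}))
      (≋-trans (proj₂ (multiple q b eq)) (+-cong≋ (·-congˡ z (≋-sym u≋)) (≋-refl {x})))))
    where
    multiple : ∀ q b → suc b ≡ suc q * suc a →
               ∃ λ z → ((x *ᴬ x ^1+ b) +ᴬ z) ≋ ((z *ᴬ x ^1+ a) +ᴬ x)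
    multiple zero b eq = x , +-cong≋ (·-congˡ x (pow-cong x
      (≡.trans (ℕ.suc-injective eq) (ℕ.+-identityʳ a)))) ≋-refl
    -- From x (w - 1) = z (u - 1) follows x (w u - 1) = x (w - 1) u + x (u - 1) = (z u + x) (u - 1).
    multiple (suc q) b eq with multiple q (a + q * suc a) ≡.refl
    ... | z , e = (z *ᴬ u′) +ᴬ x , ≋-trans (≋-sym (+-assoc≋ (x *ᴬ x ^1+ b) (z *ᴬ u′) x))
      (+-cong≋ (≋-trans (+-cong≋ split ≋-refl)
        (≋-trans (≋-sym (·-distribʳ (x *ᴬ x ^1+ (a + q * suc a)) z u′)) (·-congʳ u′ e))) ≋-refl)
      where
      u′ = x ^1+ a
      split : (x *ᴬ x ^1+ b) ≋ ((x *ᴬ x ^1+ (a + q * suc a)) *ᴬ u′)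
      split = ≋-trans (pow-cong x (≡.trans eq (≡.trans (ℕ.+-comm (suc a) (suc q * suc a))
        (ℕ.+-suc (suc q * suc a) a)))) (≋-sym (pow-· x (suc (a + q * suc a)) a))
    z = proj₁ (multiple q b eq)

  less⇒< : ∀ {a b u w} → u ≋ x ^1+ a → w ≋ x ^1+ b → LessS u w → a < b
  less⇒< {a} {b} u≋ w≋ h = decidable-stable (a ℕ.<? b) (do
    d , num-d , e ← ∃-elim h
    k , d≋ ← num⇒pow-x num-d
    e ← ≐-elim e
    return (≡.subst (a <_) (x-pow-injective (≋-trans (·-cong u≋ d≋) (pow-· x a k))
      (≋-trans (≋-sym e) w≋)) (s≤s (ℕ.m≤m+n a k))))

  <⇒less : ∀ {a b u w} → u ≋ x ^1+ a → w ≋ x ^1+ b → a < b → LessS u w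
  <⇒less {a} {b} u≋ w≋ a<b = ∃-intro (x ^1+ d) (pow⇒num-x d ≋-refl , ≐-intro (≋-trans w≋
    (≋-trans (pow-cong x (≡.sym (ℕ.m+[n∸m]≡n a<b))) (≋-trans (≋-sym (pow-· x a d)) (·-congʳ _ (≋-sym u≋))))))
    where d = b ℕ.∸ suc a

  module _ {M E B a b : ℕ} {m e B′ i r : Elem}
    (m≋ : m ≋ x ^1+ M) (e≋ : e ≋ x ^1+ E) (B≋ : B′ ≋ x ^1+ B)
    (i≋ : i ≋ x ^1+ a) (r≋ : r ≋ x ^1+ b) where

    private
      s : ℕ
      s = suc (suc (a + b))

      l₀ : ℕ
      -- One less than s (s + 1), written so that `suc l₀` reduces to `s * suc s`; `≡.refl` proves
      -- this in `coded⇒member`.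
      l₀ = s + suc (a + b) * suc s

      ir≋ : (i *ᴬ r) ≋ x ^1+ suc (a + b)
      ir≋ = ≋-trans (·-cong i≋ r≋) (pow-· x a b)

      xir≋ : (x *ᴬ (i *ᴬ r)) ≋ x ^1+ s
      xir≋ = ·-congˡ x ir≋

      code≡ : code (suc a) (suc b) ≡ s * suc s + suc a
      code≡ = ≡.cong (λ k → k * suc k + suc a) (≡.cong suc (ℕ.+-suc a b))

      P : Elem
      P = x ^1+ l₀

      P≋ : P ≋ x ^1+ l₀
      P≋ = ≋-refl

      s∣P : DividesS (i *ᴬ r) P
      s∣P = ∣⇒divides {suc (a + b)} {l₀} {i *ᴬ r} {P} ir≋ P≋ (m∣m*n (suc s))

      s+1∣P : DividesS (x *ᴬ (i *ᴬ r)) P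
      s+1∣P = ∣⇒divides {s} {l₀} {x *ᴬ (i *ᴬ r)} {P} xir≋ P≋ (n∣m*n s)

      module _ {l : ℕ} {L : Elem} (l≡ : suc l ≡ s * suc s) (L≋ : L ≋ x ^1+ l) where
        value : suc (suc (l + a)) ≡ code (suc a) (suc b)
        value = ≡.trans (≡.cong suc (≡.sym (ℕ.+-suc l a))) (≡.trans (≡.cong (_+ suc a) l≡) (≡.sym code≡))

        Li≋ : (L *ᴬ i) ≋ x ^1+ suc (l + a)
        Li≋ = ≋-trans (·-cong L≋ i≋) (pow-· x l a)

        Lie≋ : ((L *ᴬ i) *ᴬ e) ≋ x ^1+ suc (suc (l + a) + E)
        Lie≋ = ≋-trans (·-cong Li≋ e≋) (pow-· x (suc (l + a)) E)

        shifted-value : suc (suc (suc (l + a) + E)) ≡ code (suc a) (suc b) + suc E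
        shifted-value = ≡.trans (≡.sym (ℕ.+-suc (suc (suc (l + a))) E)) (≡.cong (_+ suc E) value)

    -- The minimality clause is used at `P`, the power with exponent s (s + 1), so the exponent of
    -- the witness divides s (s + 1). It is also a multiple, as s and s + 1 are coprime, and
    -- antisymmetry determines it.
    member⇒coded : Member x m e B′ i r → Coded M E B (code (suc a) (suc b))
    member⇒coded h = decidable-stable
      ((code (suc a) (suc b) ℕ.<? suc B) ×-dec (code (suc a) (suc b) + suc E ∣? suc M))
      (∃-elim h >>= λ (L , num-L , s∣L , s+1∣L , least , less , div) →
        num⇒pow-x {L} num-L >>= λ (l , L≋) →
        return (coded L l L≋ (multiple≡ L l L≋ s∣L s+1∣L
          (least P (pow⇒num-x l₀ {P} P≋) s∣P s+1∣P)) less div))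
      where
      multiple≡ : ∀ L l → L ≋ x ^1+ l → DividesS (i *ᴬ r) L → DividesS (x *ᴬ (i *ᴬ r)) L →
                  DividesS L P → suc l ≡ s * suc s
      multiple≡ L l L≋ s∣L s+1∣L L∣P = ∣-antisym
        (divides⇒∣ {l} {l₀} {L} {P} L≋ P≋ L∣P)
        (consecutive-product-∣ s (suc l)
          (divides⇒∣ {suc (a + b)} {l} {i *ᴬ r} {L} ir≋ L≋ s∣L)
          (divides⇒∣ {s} {l} {x *ᴬ (i *ᴬ r)} {L} xir≋ L≋ s+1∣L))
      coded : ∀ L l → L ≋ x ^1+ l → suc l ≡ s * suc s → LessS (L *ᴬ i) B′ →
              DividesS ((L *ᴬ i) *ᴬ e) m → Coded M E B (code (suc a) (suc b))
      coded L l L≋ l≡ less div =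
        ≡.subst (_< suc B) (value l≡ L≋)
          (s≤s (less⇒< {suc (l + a)} {B} {L *ᴬ i} {B′} (Li≋ l≡ L≋) B≋ less)) ,
        ≡.subst (_∣ suc M) (shifted-value l≡ L≋)
          (divides⇒∣ {suc (suc (l + a) + E)} {M} {(L *ᴬ i) *ᴬ e} {m} (Lie≋ l≡ L≋) m≋ div)

    coded⇒member : Coded M E B (code (suc a) (suc b)) → Member x m e B′ i r
    coded⇒member (v<B , v∣M) = ∃-intro P (pow⇒num-x l₀ {P} P≋ , s∣P , s+1∣P , least ,
      <⇒less {suc (l₀ + a)} {B} {P *ᴬ i} {B′} (Li≋ {l₀} {P} ≡.refl P≋) B≋
        (ℕ.≤-pred (≡.subst (_< suc B) (≡.sym (value {l₀} {P} ≡.refl P≋)) v<B)) ,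
      ∣⇒divides {suc (suc (l₀ + a) + E)} {M} {(P *ᴬ i) *ᴬ e} {m} (Lie≋ {l₀} {P} ≡.refl P≋) m≋
        (≡.subst (_∣ suc M) (≡.sym (shifted-value {l₀} {P} ≡.refl P≋)) v∣M))
      where
      least : ∀ L′ → Num x L′ → DividesS (i *ᴬ r) L′ → DividesS (x *ᴬ (i *ᴬ r)) L′ → DividesS P L′
      least L′ num-L′ s∣L′ s+1∣L′ nope = num⇒pow-x {L′} num-L′ λ (l′ , L′≋) →
        ∣⇒divides {l₀} {l′} {P} {L′} P≋ L′≋ (consecutive-product-∣ s (suc l′)
          (divides⇒∣ {suc (a + b)} {l′} {i *ᴬ r} {L′} ir≋ L′≋ s∣L′)
          (divides⇒∣ {s} {l′} {x *ᴬ (i *ᴬ r)} {L′} xir≋ L′≋ s+1∣L′)) nope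

-- A generator is good.

module GoodGenerator {c ℓ : Level} (K : Field c ℓ) (m : ℕ) where
  open FreeAlgebra K (suc m)
  open FreeAlgebraLaws K (suc m)
  open DoubleNegation
  open Numerals K (suc m)
  open Generator K m using (x)
  open StandardModel K m
  open FiniteSetCoding

  base-x : Base x
  base-x u u≐x = Num-x-stable {u} (≐-elim u≐x >>= λ u≋x → return (pow⇒num-x 0 {u} u≋x))

  closed-x : Closed x
  closed-x u v num-u v≐xu = Num-x-stable {v}
    (num⇒pow-x {u} num-u >>= λ (k , u≋) → ≐-elim v≐xu >>= λ v≋xu →
    return (pow⇒num-x (suc k) {v} (≋-trans v≋xu (·-congˡ x u≋))))

  predecessor-x : Predecessor x
  predecessor-x u num-u (u≠x , no-pred) = num-predecessor {u} num-u λ where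
    (inj₁ u≋x)                → u≠x (≐-intro u≋x)
    (inj₂ (v , num-v , u≋xv)) → no-pred λ none → none v (num-v , ≐-intro u≋xv)

  empty-set-x : EmptySet x
  -- The bound x has index 0, the bound for which `coded-empty` is stated.
  empty-set-x = ∃-intro (x ^1+ M) (∃-intro (x ^1+ E) (∃-intro x
    ((pow⇒num-x 0 {x} ≋-refl , pow⇒num-x E {x ^1+ E} ≋-refl , pow⇒num-x M {x ^1+ M} ≋-refl) , none)))
    where
    M E : ℕ
    M = proj₁ coded-empty
    E = proj₁ (proj₂ coded-empty)
    none : ∀ i r → Num x i → Num x r → Member x (x ^1+ M) (x ^1+ E) x i r → Lift (c ⊔ ℓ) ⊥
    none i r num-i num-r mem = lift (num⇒pow-x {i} num-i λ (a , i≋) →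
      num⇒pow-x {r} num-r λ (b , r≋) → proj₂ (proj₂ coded-empty) _
        (member⇒coded {M} {E} {0} {a} {b} {x ^1+ M} {x ^1+ E} {x} ≋-refl ≋-refl ≋-refl i≋ r≋ mem))

  module _ {μ ε β i₀ r₀ : Elem} {M E B a₀ b₀ : ℕ} (μ≋ : μ ≋ x ^1+ M) (ε≋ : ε ≋ x ^1+ E)
    (β≋ : β ≋ x ^1+ B) (i₀≋ : i₀ ≋ x ^1+ a₀) (r₀≋ : r₀ ≋ x ^1+ b₀)
    {M′ E′ B′ : ℕ} (spec : ∀ v →
      (Coded M′ E′ B′ v → Coded M E B v ⊎ v ≡ code (suc a₀) (suc b₀)) ×
      (Coded M E B v ⊎ v ≡ code (suc a₀) (suc b₀) → Coded M′ E′ B′ v)) where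

    μ′ ε′ β′ : Elem
    μ′ = x ^1+ M′
    ε′ = x ^1+ E′
    β′ = x ^1+ B′

    old-or-new : ∀ {i r a b} → i ≋ x ^1+ a → r ≋ x ^1+ b → Member x μ′ ε′ β′ i r →
                 ¬ (¬ Member x μ ε β i r × ¬ New x i₀ r₀ i r)
    old-or-new {i} {r} {a} {b} i≋ r≋ mem (not-old , not-new) =
      by-cases-on (proj₁ (spec (code (suc a) (suc b)))
        (member⇒coded {M′} {E′} {B′} {a} {b} {μ′} {ε′} {β′} ≋-refl ≋-refl ≋-refl i≋ r≋ mem))
      where
      new-pair : suc a ≡ suc a₀ → suc b ≡ suc b₀ → New x i₀ r₀ i r
      new-pair a≡ b≡ =
        ≐-intro (≋-trans i≋ (≋-trans (pow-cong x (ℕ.suc-injective a≡)) (≋-sym i₀≋))) ,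
        ≐-intro (≋-trans r≋ (≋-trans (pow-cong x (ℕ.suc-injective b≡)) (≋-sym r₀≋)))
      by-cases-on : Coded M E B (code (suc a) (suc b)) ⊎ code (suc a) (suc b) ≡ code (suc a₀) (suc b₀) → ⊥
      by-cases-on (inj₁ cv) = not-old (coded⇒member {M} {E} {B} {a} {b} {μ} {ε} {β} μ≋ ε≋ β≋ i≋ r≋ cv)
      by-cases-on (inj₂ eq) = not-new (new-pair (proj₁ pairs≡) (proj₂ pairs≡))
        where
        pairs≡ : suc a ≡ suc a₀ × suc b ≡ suc b₀
        pairs≡ = code-injective {suc a} {suc b} {suc a₀} {suc b₀} eq

    still-member : ∀ {i r a b} → i ≋ x ^1+ a → r ≋ x ^1+ b →
                   Coded M E B (code (suc a) (suc b)) ⊎ code (suc a) (suc b) ≡ code (suc a₀) (suc b₀) →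
                   Member x μ′ ε′ β′ i r
    still-member {i} {r} {a} {b} i≋ r≋ h =
      coded⇒member {M′} {E′} {B′} {a} {b} {μ′} {ε′} {β′} ≋-refl ≋-refl ≋-refl i≋ r≋ (proj₂ (spec _) h)

    adjoined : Adjoined x μ ε β i₀ r₀ μ′ ε′ β′
    adjoined i r num-i num-r =
      (λ mem h → num⇒pow-x {i} num-i λ (a , i≋) → num⇒pow-x {r} num-r λ (b , r≋) →
        old-or-new {i} {r} {a} {b} i≋ r≋ mem h) ,
      (λ h none → num⇒pow-x {i} num-i λ (a , i≋) → num⇒pow-x {r} num-r λ (b , r≋) →
        apart {a} {b} i≋ r≋ h λ mem → mem none)
      where
      apart : ∀ {a b} → i ≋ x ^1+ a → r ≋ x ^1+ b →
              ¬ (¬ Member x μ ε β i r × ¬ New x i₀ r₀ i r) → ¬ ¬ Member x μ′ ε′ β′ i r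
      apart {a} {b} i≋ r≋ h not-member = h (not-old , not-new)
        where
        not-old : ¬ Member x μ ε β i r
        not-old old = not-member (still-member {i} {r} {a} {b} i≋ r≋ (inj₁
          (member⇒coded {M} {E} {B} {a} {b} {μ} {ε} {β} μ≋ ε≋ β≋ i≋ r≋ old)))
        not-new : ¬ New x i₀ r₀ i r
        not-new (i≐ , r≐) = ≐-elim i≐ λ i≋i₀ → ≐-elim r≐ λ r≋r₀ →
          not-member (still-member {i} {r} {a} {b} i≋ r≋ (inj₂ (≡.cong₂ (λ a b → code (suc a) (suc b))
            (x-pow-injective {a} {a₀} {i} i≋ (≋-trans i≋i₀ i₀≋))
            (x-pow-injective {b} {b₀} {r} r≋ (≋-trans r≋r₀ r₀≋)))))

  adjoin-x : Adjoin x
  adjoin-x μ ε β i₀ r₀ (num-μ , num-ε , num-β) num-i₀ num-r₀ none =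
    num⇒pow-x {μ} num-μ λ (M , μ≋) → num⇒pow-x {ε} num-ε λ (E , ε≋) →
    num⇒pow-x {β} num-β λ (B , β≋) → num⇒pow-x {i₀} num-i₀ λ (a₀ , i₀≋) →
    num⇒pow-x {r₀} num-r₀ λ (b₀ , r₀≋) →
    extend-set μ≋ ε≋ β≋ i₀≋ r₀≋ (coded-adjoin M E B (code (suc a₀) (suc b₀)))
    where
    extend-set : ∀ {M E B a₀ b₀} → μ ≋ x ^1+ M → ε ≋ x ^1+ E → β ≋ x ^1+ B →
      i₀ ≋ x ^1+ a₀ → r₀ ≋ x ^1+ b₀ →
      (∃ λ M′ → ∃ λ E′ → ∃ λ B′ → ∀ v →
        (Coded M′ E′ B′ v → Coded M E B v ⊎ v ≡ code (suc a₀) (suc b₀)) ×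
        (Coded M E B v ⊎ v ≡ code (suc a₀) (suc b₀) → Coded M′ E′ B′ v)) → ⊥
    extend-set μ≋ ε≋ β≋ i₀≋ r₀≋ (M′ , E′ , B′ , spec) =
      none (x ^1+ M′) λ none → none (x ^1+ E′) λ none → none (x ^1+ B′)
        ((pow⇒num-x M′ {x ^1+ M′} ≋-refl , pow⇒num-x E′ {x ^1+ E′} ≋-refl ,
          pow⇒num-x B′ {x ^1+ B′} ≋-refl) ,
         adjoined {μ} {ε} {β} {i₀} {r₀} μ≋ ε≋ β≋ i₀≋ r₀≋ spec)

  good-x : Good x
  good-x = good-intro {x} base-x closed-x predecessor-x empty-set-x adjoin-x

theorem9p2 : ∀ {c ℓ : Level} (K : Field c ℓ) (m : ℕ) → TheoryUndecidable K (suc m)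
theorem9p2 K m = good⇒undecidable K (suc m) (Generator.x K m) (GoodGenerator.good-x K m)
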